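{- Let $G$ be a clean 2-dd all of whose alternating cycles have exactly 6 arcs, and suppose $G$ is odd, connected and not 2-splittable. Let $F$ be a subgraph of $G$ with exactly 3 alternating cycles and exactly $s$ saturated vertices, and suppose that $F$ does not contain a subgraph with exactly 2 alternating cycles and more than 2 saturated vertices. If $s>4$, then we can either collapse $F$ entirely, or replace $F$ with a single alternating cycle with 6 arcs, or replace $F$ with a 2-digraph consisting of a pair of alternating cycles with 6 arcs each, so as to obtain an odd 2-dd $G'$, all of whose alternating cycles have exactly 6 arcs, which is H-equivalent to $G$.
   Context: A 2-digraph is a finite digraph in which each vertex has (in-degree, out-degree) equal to $(0,2)$ (an entry vertex), $(2,0)$ (an exit vertex) or $(2,2)$ (a saturated vertex). A 2-dd is a 2-digraph all of whose vertices are saturated. Connected means that the underlying undirected graph is connected. An alternating cycle (AC) is a sequence of $2r$ distinct arcs $(e_0,\dots,e_{2r-1})$ such that $e_i$ and $e_{i+1}$ (indices mod $2r$) have a common end-vertex if $i$ is even and a common start-vertex if $i$ is odd; its forward arcs are the $e_i$ with $i$ even and its backward arcs those with $i$ odd. The arc set of a 2-digraph is uniquely partitioned into ACs. An AC is clean if no vertex is both the start-vertex of one of its arcs and the end-vertex of one of its arcs; a 2-digraph is clean if all its ACs are clean. A subgraph of a 2-digraph means the 2-digraph induced by a non-empty set of its ACs (all arcs of these ACs and their end-points). Entry, exit and saturated vertices of a subgraph $F$ are with respect to degrees in $F$. The complement $\overline{F}$ of a subgraph $F$ of $G$ is the subgraph induced by the remaining ACs of $G$; the entry vertices of $F$ are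 exactly the exit vertices of $\overline{F}$ and vice versa. A factor of a 2-digraph is a spanning subgraph which, for every AC, contains either all its forward arcs and none of its backward arcs, or vice versa; it is a disjoint union of directed cycles and directed paths from entry to exit vertices. A factor is open if it contains no cycle. The route of a factor is the bijection from entry vertices to exit vertices sending each entry vertex to the end of the path starting there; a route is open if it is the route of at least one open factor. A 2-dd is odd if every one of its factors has an odd number of cycles. It is Hamiltonian if it has a directed cycle through all vertices. Two 2-dds are H-equivalent if both are Hamiltonian or both are non-Hamiltonian. Splitting a saturated vertex $v$ means replacing it by two vertices $v^{in},v^{out}$, the two in-arcs of $v$ becoming in-arcs of $v^{in}$ and the two out-arcs becoming out-arcs of $v^{out}$. $G$ is 2-splittable if there is a set of 2 saturated vertices such that splitting both increases the number of connected components. Collapsing $F$: for an open route $r$ of $F$, form a 2-dd from $\overline{F}$ by identifying each entry vertex $u$ of $F$ with the exit vertex $r(u)$ of $F$ (arcs and saturated vertices of $F$ are deleted). Replacing $F$ by a 2-digraph $F'$ with the same number of exit vertices as $F$: form a 2-dd from the disjoint union of $\overline{F}$ and $F'$ by identifying the exit vertices of $\overline{F}$ with the entry vertices of $F'$ via some bijection and the exit vertices of $F'$ with the entry vertices of $\overline{F}$ via some bijection. The claim asserts that some such choice produces a $G'$ as stated. -}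

module Defs where

open import Data.Nat using (ℕ; zero; suc; _+_; _*_; _<_; _%_; NonZero)
import Data.Nat.Properties as ℕ
open import Data.Nat.DivMod using (_mod_)
open import Data.Fin using (Fin; toℕ; join; splitAt; _↑ˡ_; _↑ʳ_)
import Data.Fin.Properties as Fin
open import Data.Fin.Subset using (Subset; _∈_; _∉_; _⊆_; _─_; ∣_∣; Nonempty)
open import Data.Fin.Subset.Properties using (_∈?_; p─q⊆p)
open import Data.Product using (Σ; ∃; ∃-syntax; _×_; _,_; proj₁; proj₂)
open import Data.Product.Properties using (≡-dec)
open import Data.Sum as Sum using (_⊎_; inj₁; inj₂)
open import Data.Vec using (tabulate; _++_)
open import Data.Vec.Properties
  using (lookup∘tabulate; lookup⇒[]=; []=⇒lookup; lookup-++ˡ; lookup-++ʳ)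
open import Function using (_on_)
open import Function.Bundles using (_⇔_; _↔_; Inverse)
open import Function.Definitions using (Injective; Bijective)
open import Level using (0ℓ)
open import Relation.Binary using (Rel)
open import Relation.Binary.Construct.Closure.Equivalence using (EqClosure)
open import Relation.Binary.Construct.Closure.ReflexiveTransitive using (Star)
open import Relation.Binary.PropositionalEquality using (_≡_; refl; sym; trans; subst)
open import Relation.Nullary using (¬_; does; yes; no; _×-dec_; _⊎-dec_)
open import Relation.Nullary.Decidable using (dec-true)
open import Relation.Unary using (Pred; Decidable) renaming (_⊆_ to _⊆ᴾ_)

⟦_⟧ : ∀ {n} {P : Pred (Fin n) 0ℓ} → Decidable P → Subset n
⟦ P? ⟧ = tabulate (λ i → does (P? i))

∈⟦⟧⁺ : ∀ {n} {P : Pred (Fin n) 0ℓ} (P? : Decidable P) {i} → P i → i ∈ ⟦ P? ⟧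
∈⟦⟧⁺ P? {i} p =
  lookup⇒[]= i _ (trans (lookup∘tabulate _ i) (dec-true (P? i) p))

∈-++ˡ : ∀ {m n} (p : Subset m) (q : Subset n) {i} → i ∈ p → (i ↑ˡ n) ∈ (p ++ q)
∈-++ˡ p q {i} i∈p = lookup⇒[]= _ _ (trans (lookup-++ˡ p q i) ([]=⇒lookup i∈p))

∈-++ʳ : ∀ {m n} (p : Subset m) (q : Subset n) {i} → i ∈ q → (m ↑ʳ i) ∈ (p ++ q)
∈-++ʳ p q {i} i∈q = lookup⇒[]= _ _ (trans (lookup-++ʳ p q i) ([]=⇒lookup i∈q))

-- X has exactly k elements up to _≈_.
HasSize : (X : Set) → Rel X 0ℓ → ℕ → Set
HasSize X _≈_ k = Σ (Fin k → X) (Bijective _≡_ _≈_)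

-- Two finite sequences with the same set of terms.
SameTerms : {A : Set} {k l : ℕ} → (Fin k → A) → (Fin l → A) → Set
SameTerms f g = ∀ a → (∃[ i ] f i ≡ a) ⇔ (∃[ j ] g j ≡ a)

next : ∀ {k} → Fin k → Fin k
next {suc k} i = suc (toℕ i) mod suc k

-- Vertices and arcs are sets of labels drawn from Fin n and Fin m, so that
-- a subgraph shares the labels of the ambient graph.  Loops and parallel
-- arcs are allowed, since identifying vertices may create them.
record Digraph : Set where
  field
    n m     : ℕ
    V       : Subset n
    A       : Subset m
    src tgt : Fin m → Fin n
    src∈    : ∀ {e} → e ∈ A → src e ∈ V
    tgt∈    : ∀ {e} → e ∈ A → tgt e ∈ V

open Digraph public

Vertex : Digraph → Set
Vertex H = ∃[ v ] v ∈ V H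

indeg outdeg : (H : Digraph) → Fin (n H) → ℕ
indeg  H v = ∣ ⟦ (λ e → (e ∈? A H) ×-dec (tgt H e Fin.≟ v)) ⟧ ∣
outdeg H v = ∣ ⟦ (λ e → (e ∈? A H) ×-dec (src H e Fin.≟ v)) ⟧ ∣

verticesOfDegree : (H : Digraph) → ℕ × ℕ → Subset (n H)
verticesOfDegree H d =
  ⟦ (λ v → (v ∈? V H) ×-dec ≡-dec ℕ._≟_ ℕ._≟_ (indeg H v , outdeg H v) d) ⟧

entries exits saturated : (H : Digraph) → Subset (n H)
entries   H = verticesOfDegree H (0 , 2)
exits     H = verticesOfDegree H (2 , 0)
saturated H = verticesOfDegree H (2 , 2)

EntryVertex ExitVertex : Digraph → Set
EntryVertex H = ∃[ v ] v ∈ entries H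
ExitVertex  H = ∃[ v ] v ∈ exits H

Is2Digraph : Digraph → Set
Is2Digraph H = ∀ {v} → v ∈ V H → v ∈ entries H ⊎ v ∈ exits H ⊎ v ∈ saturated H

Is2dd : Digraph → Set
Is2dd H = Is2Digraph H × (∀ {v} → v ∈ V H → v ∈ saturated H)

Adj : (H : Digraph) → Rel (Fin (n H)) 0ℓ
Adj H u v = ∃[ e ] e ∈ A H × src H e ≡ u × tgt H e ≡ v

Linked : (H : Digraph) → Rel (Vertex H) 0ℓ
Linked H = EqClosure (Adj H) on proj₁

Connected : Digraph → Set
Connected H = ∀ u v → Linked H u v

HasComponents : Digraph → ℕ → Set
HasComponents H = HasSize (Vertex H) (Linked H)

-- Splits every vertex v of S: v ↑ˡ n plays the role of vⁱⁿ and n ↑ʳ v that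
-- of vᵒᵘᵗ.
split : (H : Digraph) → Subset (n H) → Digraph
split H S = record
  { n    = n H + n H
  ; m    = m H
  ; V    = V H ++ S
  ; A    = A H
  ; src  = src′
  ; tgt  = λ e → tgt H e ↑ˡ n H
  ; src∈ = src′∈
  ; tgt∈ = λ e∈A → ∈-++ˡ (V H) S (tgt∈ H e∈A)
  }
  where
  src′ : Fin (m H) → Fin (n H + n H)
  src′ e with src H e ∈? S
  ... | yes _ = n H ↑ʳ src H e
  ... | no  _ = src H e ↑ˡ n H

  src′∈ : ∀ {e} → e ∈ A H → src′ e ∈ (V H ++ S)
  src′∈ {e} e∈A with src H e ∈? S
  ... | yes s∈S = ∈-++ʳ (V H) S s∈S
  ... | no  _   = ∈-++ˡ (V H) S (src∈ H e∈A)

TwoSplittable : Digraph → Set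
TwoSplittable H =
  ∃[ S ] S ⊆ saturated H × ∣ S ∣ ≡ 2 ×
    (∃[ k ] ∃[ k′ ] HasComponents H k × HasComponents (split H S) k′ × k < k′)

induced : (H : Digraph) (S : Subset (m H)) → Digraph
induced H S = record
  { n    = n H
  ; m    = m H
  ; V    = ⟦ isEnd? ⟧
  ; A    = S
  ; src  = src H
  ; tgt  = tgt H
  ; src∈ = λ {e} e∈S → ∈⟦⟧⁺ isEnd? (e , e∈S , inj₁ refl)
  ; tgt∈ = λ {e} e∈S → ∈⟦⟧⁺ isEnd? (e , e∈S , inj₂ refl)
  }
  where
  isEnd? : Decidable (λ v → ∃[ e ] e ∈ S × (src H e ≡ v ⊎ tgt H e ≡ v))
  isEnd? v = Fin.any? λ e →
    (e ∈? S) ×-dec ((src H e Fin.≟ v) ⊎-dec (tgt H e Fin.≟ v))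

spanning : (H : Digraph) (S : Subset (m H)) → S ⊆ A H → Digraph
spanning H S S⊆A = record
  { n    = n H
  ; m    = m H
  ; V    = V H
  ; A    = S
  ; src  = src H
  ; tgt  = tgt H
  ; src∈ = λ e∈S → src∈ H (S⊆A e∈S)
  ; tgt∈ = λ e∈S → tgt∈ H (S⊆A e∈S)
  }

_⊎ᴰ_ : Digraph → Digraph → Digraph
H ⊎ᴰ K = record
  { n    = n H + n K
  ; m    = m H + m K
  ; V    = V H ++ V K
  ; A    = A H ++ A K
  ; src  = λ e → join (n H) (n K) (Sum.map (src H) (src K) (splitAt (m H) e))
  ; tgt  = λ e → join (n H) (n K) (Sum.map (tgt H) (tgt K) (splitAt (m H) e))
  ; src∈ = ends∈ (src H) (src K) (src∈ H) (src∈ K)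
  ; tgt∈ = ends∈ (tgt H) (tgt K) (tgt∈ H) (tgt∈ K)
  }
  where
  ends∈ : (f : Fin (m H) → Fin (n H)) (g : Fin (m K) → Fin (n K)) →
          (∀ {e} → e ∈ A H → f e ∈ V H) → (∀ {e} → e ∈ A K → g e ∈ V K) →
          ∀ {e} → e ∈ (A H ++ A K) →
          join (n H) (n K) (Sum.map f g (splitAt (m H) e)) ∈ (V H ++ V K)
  ends∈ f g f∈ g∈ {e} e∈ with splitAt (m H) e in eq
  ... | inj₁ i = ∈-++ˡ (V H) (V K) (f∈ (lookup⇒[]= i _
        (trans (sym (lookup-++ˡ (A H) (A K) i))
          ([]=⇒lookup (subst (_∈ _) (sym (Fin.splitAt⁻¹-↑ˡ eq)) e∈)))))
  ... | inj₂ j = ∈-++ʳ (V H) (V K) (g∈ (lookup⇒[]= j _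
        (trans (sym (lookup-++ʳ (A H) (A K) j))
          ([]=⇒lookup (subst (_∈ _) (sym (Fin.splitAt⁻¹-↑ʳ {m H} eq)) e∈)))))

record Cycle (H : Digraph) : Set where
  field
    len             : ℕ
    .{{nonZero}}    : NonZero len
    arc             : Fin len → Fin (m H)
    arc∈            : ∀ i → arc i ∈ A H
    consecutive     : ∀ i → tgt H (arc i) ≡ src H (arc (next i))
    simple          : Injective _≡_ _≡_ (λ i → src H (arc i))

-- Cycles differing only in their starting point are the same cycle.
HasCycles : Digraph → ℕ → Set
HasCycles H =
  HasSize (Cycle H) (λ C D → SameTerms (Cycle.arc C) (Cycle.arc D))

Hamiltonian : Digraph → Set
Hamiltonian H =
  Σ (Cycle H) λ C → ∀ {v} → v ∈ V H → ∃[ i ] src H (Cycle.arc C i) ≡ v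

HEquivalent : Digraph → Digraph → Set
HEquivalent G H =
  (Hamiltonian G × Hamiltonian H) ⊎ (¬ Hamiltonian G × ¬ Hamiltonian H)

record AC (H : Digraph) : Set where
  field
    r            : ℕ
    .{{nonZero}} : NonZero r
    arc          : Fin (2 * r) → Fin (m H)
    arc∈         : ∀ i → arc i ∈ A H
    distinct     : Injective _≡_ _≡_ arc
    commonEnd    : ∀ i → toℕ i % 2 ≡ 0 → tgt H (arc i) ≡ tgt H (arc (next i))
    commonStart  : ∀ i → toℕ i % 2 ≡ 1 → src H (arc i) ≡ src H (arc (next i))

  size : ℕ
  size = 2 * r

  Forward Backward : Pred (Fin (m H)) 0ℓ
  Forward  e = ∃[ i ] toℕ i % 2 ≡ 0 × arc i ≡ e
  Backward e = ∃[ i ] toℕ i % 2 ≡ 1 × arc i ≡ e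

-- An AC is counted through its set of arcs: rotating or reversing the
-- sequence does not give a new AC.
HasACs : Digraph → ℕ → Set
HasACs H = HasSize (AC H) (λ C D → SameTerms (AC.arc C) (AC.arc D))

AllACsOfSize : Digraph → ℕ → Set
AllACsOfSize H k = (C : AC H) → AC.size C ≡ k

CleanAC : (H : Digraph) → AC H → Set
CleanAC H C = ¬ (∃[ i ] ∃[ j ] src H (AC.arc C i) ≡ tgt H (AC.arc C j))

Clean : Digraph → Set
Clean H = (C : AC H) → CleanAC H C

-- The ACs partition the arcs of a 2-digraph, so a set of ACs is encoded by
-- its union: a set of arcs that splits no AC.
record Subgraph (H : Digraph) : Set where
  field
    arcs       : Subset (m H)
    arcs⊆      : arcs ⊆ A H
    nonempty   : Nonempty arcs
    unionOfACs : (C : AC H) →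
                 (∀ i → AC.arc C i ∈ arcs) ⊎ (∀ i → AC.arc C i ∉ arcs)

⟨_⟩ : ∀ {H} → Subgraph H → Digraph
⟨_⟩ {H} F = induced H (Subgraph.arcs F)

complement : ∀ {H} → Subgraph H → Digraph
complement {H} F = induced H (A H ─ Subgraph.arcs F)

record Factor (H : Digraph) : Set where
  field
    arcs    : Subset (m H)
    arcs⊆   : arcs ⊆ A H

    oneSide : (C : AC H) →
                (AC.Forward C ⊆ᴾ (_∈ arcs) × AC.Backward C ⊆ᴾ (_∉ arcs))
              ⊎ (AC.Backward C ⊆ᴾ (_∈ arcs) × AC.Forward C ⊆ᴾ (_∉ arcs))

  digraph : Digraph
  digraph = spanning H arcs arcs⊆

OddDigraph : Digraph → Set
OddDigraph H = (f : Factor H) → ∃[ k ] HasCycles (Factor.digraph f) k × k % 2 ≡ 1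

IsOpen : ∀ {H} → Factor H → Set
IsOpen f = ¬ Cycle (Factor.digraph f)

-- Exit vertices have no out-arcs, so an exit vertex reached from u inside
-- the factor is the end of the path starting at u.
IsRouteOf : ∀ {H} → (EntryVertex H ↔ ExitVertex H) → Factor H → Set
IsRouteOf ρ f =
  ∀ u → Star (Adj (Factor.digraph f)) (proj₁ u) (proj₁ (Inverse.to ρ u))

IsOpenRoute : (H : Digraph) → (EntryVertex H ↔ ExitVertex H) → Set
IsOpenRoute H ρ = Σ (Factor H) λ f → IsOpen f × IsRouteOf ρ f

-- K is, up to isomorphism, the digraph obtained from H by identifying
-- vertices related by R.
record IsGluing (H : Digraph) (R : Rel (Fin (n H)) 0ℓ) (K : Digraph) : Set where
  field
    vmap      : Fin (n H) → Fin (n K)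
    vmap∈     : ∀ {v} → v ∈ V H → vmap v ∈ V K
    vmap-surj : ∀ {w} → w ∈ V K → ∃[ v ] v ∈ V H × vmap v ≡ w
    vmap-ker  : ∀ {u v} → u ∈ V H → v ∈ V H → vmap u ≡ vmap v ⇔ EqClosure R u v
    amap      : Fin (m H) → Fin (m K)
    amap∈     : ∀ {e} → e ∈ A H → amap e ∈ A K
    amap-inj  : ∀ {d e} → d ∈ A H → e ∈ A H → amap d ≡ amap e → d ≡ e
    amap-surj : ∀ {e} → e ∈ A K → ∃[ d ] d ∈ A H × amap d ≡ e
    src-amap  : ∀ {e} → e ∈ A H → src K (amap e) ≡ vmap (src H e)
    tgt-amap  : ∀ {e} → e ∈ A H → tgt K (amap e) ≡ vmap (tgt H e)

data CollapseRel {G : Digraph} (F : Subgraph G)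
                 (ρ : EntryVertex ⟨ F ⟩ ↔ ExitVertex ⟨ F ⟩) :
                 Rel (Fin (n G)) 0ℓ where
  entry∼exit : ∀ u → CollapseRel F ρ (proj₁ u) (proj₁ (Inverse.to ρ u))

IsCollapse : {G : Digraph} → Subgraph G → Digraph → Set
IsCollapse F G′ =
  ∃[ ρ ] IsOpenRoute ⟨ F ⟩ ρ × IsGluing (complement F) (CollapseRel F ρ) G′

data ReplaceRel (H K : Digraph)
                (α : ExitVertex H ↔ EntryVertex K)
                (β : ExitVertex K ↔ EntryVertex H) :
                Rel (Fin (n H + n K)) 0ℓ where
  exit∼entry : ∀ x → ReplaceRel H K α β
                       (proj₁ x ↑ˡ n K) (n H ↑ʳ proj₁ (Inverse.to α x))
  entry∼exit : ∀ y → ReplaceRel H K α β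
                       (n H ↑ʳ proj₁ y) (proj₁ (Inverse.to β y) ↑ˡ n K)

IsReplacement : {G : Digraph} → Subgraph G → (F′ G′ : Digraph) → Set
IsReplacement F F′ G′ =
  ∣ exits F′ ∣ ≡ ∣ exits ⟨ F ⟩ ∣ ×
  (∃[ α ] ∃[ β ]
    IsGluing (complement F ⊎ᴰ F′) (ReplaceRel (complement F) F′ α β) G′)

{-# OPTIONS --safe #-}

-- Collapsing always suffices.  A factor of G restricts to a factor of F and one of the
-- complement.  If G is Hamiltonian, the restriction to F of a factor that is a Hamiltonian
-- cycle is open, and collapsing F along its route leaves a Hamiltonian cycle.  If G is not
-- Hamiltonian, collapse F along any open factor f of F: a Hamiltonian cycle of the result
-- would lift to G.  In both cases a factor of G′ together with f is a factor of G with the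
-- same number of cycles, so G′ is odd, and no AC of the complement is altered.
--
-- It remains to find an open factor of F.  Any two of its three hexagons share at most two
-- vertices, so at most four vertices of a hexagon Y are shared; hence on one side of Y at
-- most one arc joins two shared vertices.  Fix that side of Y.  If every choice of sides of
-- the other hexagons X and Z gave a cycle, then following the cycles through the few shared
-- vertices would force both sides of X, or both sides of Z, to contain an arc with the same
-- start and end.

module Submission where

open import Defs
import Data.Bool as Bool
open import Data.Bool using (Bool; true; false; not)
open import Data.Bool.Properties using (not-involutive; not-injective; ¬-not; not-¬)
open import Data.Empty using (⊥; ⊥-elim)
open import Data.Fin using (Fin; zero; suc; toℕ; fromℕ<; finToFun; funToFin; _↑ˡ_; _↑ʳ_; splitAt)
open import Data.Fin.Induction using (spo-wellFounded; spo-noetherian)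
open import Data.Fin.Patterns
import Data.Fin.Properties as Fin
open import Data.Fin.Subset
  using (Subset; _∈_; _∉_; _⊆_; _∪_; _∩_; _─_; _-_; ∣_∣; ⊤; Nonempty; inside; outside)
open import Data.Fin.Subset.Properties
  using (_∈?_; _⊆?_; nonempty?; anySubset?; x∈p∪q⁺; x∈p∪q⁻; x∈p∩q⁺; x∈p∩q⁻; p─q⊆p;
         x∈p∧x∉q⇒x∈p─q; x∈p⇒∣p-x∣<∣p∣; x∈p∧x≢y⇒x∈p-y)
open import Data.Nat
  using (ℕ; zero; suc; _+_; _*_; _^_; _∸_; _<_; _≤_; s≤s; z≤n; s≤s⁻¹; _≤?_; _%_; NonZero)
open import Data.Nat.DivMod using (m<n⇒m%n≡m; n%n≡0; m%n<n)
import Data.Nat.Properties as ℕ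
open import Data.Product using (Σ; ∃; ∃-syntax; _×_; _,_; proj₁; proj₂)
open import Data.Product.Properties using (≡-dec)
open import Data.Sum using (_⊎_; inj₁; inj₂; [_,_]′)
open import Data.Vec using ([]; _∷_; here; there; lookup)
open import Data.Vec.Properties using (lookup∘tabulate; []=⇒lookup; tabulate-cong)
open import Data.Vec.Properties.WithK using ([]=-irrelevant)
open import Function using (_∘_; id; flip; case_of_)
open import Function.Bundles using (_⇔_; _↔_; Equivalence; mk⇔; mk↔ₛ′)
open import Function.Definitions using (Injective)
open import Induction.WellFounded using (Acc; acc)
open import Level using (0ℓ)
open import Relation.Binary using (IsStrictPartialOrder)
open import Relation.Binary.Construct.Closure.Equivalence as Eq using (EqClosure; gfold)
open import Relation.Binary.Construct.Closure.ReflexiveTransitive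
  using (Star; ε; _◅_; _◅◅_; reverse)
open import Relation.Binary.Construct.Closure.Symmetric using (bwd)
open import Relation.Binary.Construct.Closure.Transitive using (TransClosure; [_]; _∷_; _++_)
open import Relation.Binary.PropositionalEquality
open import Relation.Nullary
  using (¬_; Dec; does; yes; no; contradiction; _×-dec_; _⊎-dec_; _→-dec_; ¬?)
open import Relation.Nullary.Decidable
  using (map′; from-no; decidable-stable; does-⇔; dec-false)
open import Relation.Unary using (Pred; Decidable) renaming (_⊆_ to _⊆ᴾ_)

-- A cycle that crosses Y enters and leaves it at shared vertices. With a single arc of that kind on
-- the fixed side of Y, all four choices of sides for X and Z can cross Y only along this same arc,
-- so cycles belonging to different choices become comparable. The neighbours of the arc are fixed
-- too, and by the symmetry of X and Z two cases remain: from Z back to Z, and from X to Z.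
--
-- Cycles in F are treated as sets of arcs without order, so that acyclicity is decidable by finite
-- search. The factor condition is used locally: of two arcs with a common start or a common end,
-- exactly one is taken. In this form factors of F and of the complement can be united and
-- restricted arc by arc. Numbers of cycles are compared as numbers of reachability classes:
-- contracting the paths of an open factor of F neither merges nor splits a class, and loses none,
-- because no cycle lies inside F. Since the factor to collapse along depends on whether G is
-- Hamiltonian, that question is decided by exhaustive search.

∣p∪q∣≤∣p∣+∣q∣ : ∀ {n} (p q : Subset n) → ∣ p ∪ q ∣ ≤ ∣ p ∣ + ∣ q ∣
∣p∪q∣≤∣p∣+∣q∣ []            []            = z≤n
∣p∪q∣≤∣p∣+∣q∣ (outside ∷ p) (outside ∷ q) = ∣p∪q∣≤∣p∣+∣q∣ p q
∣p∪q∣≤∣p∣+∣q∣ (inside  ∷ p) (outside ∷ q) = s≤s (∣p∪q∣≤∣p∣+∣q∣ p q)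
∣p∪q∣≤∣p∣+∣q∣ (outside ∷ p) (inside  ∷ q) =
  ℕ.≤-trans (s≤s (∣p∪q∣≤∣p∣+∣q∣ p q)) (ℕ.≤-reflexive (sym (ℕ.+-suc _ _)))
∣p∪q∣≤∣p∣+∣q∣ (inside  ∷ p) (inside  ∷ q) =
  s≤s (ℕ.≤-trans (∣p∪q∣≤∣p∣+∣q∣ p q) (ℕ.+-monoʳ-≤ ∣ p ∣ (ℕ.n≤1+n _)))

-- The two sides of a hexagon.

pred₃ succ₃ : Fin 3 → Fin 3
pred₃ 0F = 2F
pred₃ 1F = 0F
pred₃ 2F = 1F
succ₃ 0F = 1F
succ₃ 1F = 2F
succ₃ 2F = 0F

-- The arc of side b leaving the i-th start of a hexagon enters its π b i-th end.
π : Bool → Fin 3 → Fin 3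
π true  i = i
π false i = pred₃ i

π-distinct : ∀ i → π true i ≢ π false i
π-distinct 0F ()
π-distinct 1F ()
π-distinct 2F ()

∈⟦⟧⁻ : ∀ {n} {P : Pred (Fin n) 0ℓ} (P? : Decidable P) {i} → i ∈ ⟦ P? ⟧ → P i
∈⟦⟧⁻ P? {i} i∈ with P? i in eq
... | yes p = p
... | no  _ = contradiction (trans (sym (trans (lookup∘tabulate _ i) (cong does eq))) ([]=⇒lookup i∈)) λ ()

-- Shared vertices of a hexagon: its starts are labelled 0, 1, 2 and its ends 3, 4, 5.
AtMostOneConnection : Subset 6 → Bool → Set
AtMostOneConnection U b = ∀ i j →
  (i ↑ˡ 3 ∈ U × 3 ↑ʳ π b i ∈ U) → (j ↑ˡ 3 ∈ U × 3 ↑ʳ π b j ∈ U) → i ≡ j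

atMostOneConnection? : ∀ U b → Dec (AtMostOneConnection U b)
atMostOneConnection? U b = Fin.all? λ i → Fin.all? λ j →
  ((_ ∈? U) ×-dec (_ ∈? U)) →-dec (((_ ∈? U) ×-dec (_ ∈? U)) →-dec (i Fin.≟ j))

-- A hexagon is a 6-cycle as an undirected graph, and four of its vertices span at most three edges,
-- whereas two connections on each side would make four. The subsets are checked exhaustively.
some-side-has-at-most-one-connection : ∀ (U : Subset 6) → ∣ U ∣ ≤ 4 → ∃ (AtMostOneConnection U)
some-side-has-at-most-one-connection U ∣U∣≤4 =
  case decidable-stable (atMostOneConnection? U true ⊎-dec atMostOneConnection? U false)
                        (λ ¬one → exhaustive (U , ∣U∣≤4 , ¬one)) of λ where
    (inj₁ one) → true  , one
    (inj₂ one) → false , one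
  where
  exhaustive : ¬ (∃[ U ] ∣ U ∣ ≤ 4 × ¬ (AtMostOneConnection U true ⊎ AtMostOneConnection U false))
  exhaustive = from-no (anySubset? λ U → (∣ U ∣ ≤? 4) ×-dec
    ¬? (atMostOneConnection? U true ⊎-dec atMostOneConnection? U false))

-- Circulations through three hexagons.

module ThreeHexagons {n} (s t : Fin 3 → Fin 3 → Fin n)
  (s-injective : ∀ {x i y j} → s x i ≡ s y j → x ≡ y × i ≡ j)
  (t-injective : ∀ {x i y j} → t x i ≡ t y j → x ≡ y × i ≡ j)
  (s≢t : ∀ x i j → s x i ≢ t x j)
  where

  -- By `s-injective` and `t-injective`, two different hexagons can only meet in an end of one that
  -- is a start of the other.
  Shared : Fin 3 → Fin 3 → Fin n → Set
  Shared x y v = (∃[ i ] ∃[ j ] t x i ≡ v × s y j ≡ v) ⊎ (∃[ i ] ∃[ j ] s x i ≡ v × t y j ≡ v)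

  shared? : ∀ x y v → Dec (Shared x y v)
  shared? x y v =
    (Fin.any? λ i → Fin.any? λ j → (t x i Fin.≟ v) ×-dec (s y j Fin.≟ v)) ⊎-dec
    (Fin.any? λ i → Fin.any? λ j → (s x i Fin.≟ v) ×-dec (t y j Fin.≟ v))

  -- `Pass x i` says that the chosen arc leaving the `i`-th start of hexagon `x` is traversed. A
  -- nonempty set of passes, each with a successor and a predecessor, stands for a union of cycles
  -- and records no order.
  record Circulation (c : Fin 3 → Bool) : Set₁ where
    field
      Pass    : Fin 3 → Fin 3 → Set
      some    : ∃[ x ] ∃[ i ] Pass x i
      forth   : ∀ {x i} → Pass x i → ∃[ y ] ∃[ j ] Pass y j × t x (π (c x) i) ≡ s y j
      back    : ∀ {y j} → Pass y j → ∃[ x ] ∃[ i ] Pass x i × t x (π (c x) i) ≡ s y j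

  s-injective′ : ∀ {x i j} → s x i ≡ s x j → i ≡ j
  s-injective′ eq = proj₂ (s-injective eq)

  t-injective′ : ∀ {x i j} → t x i ≡ t x j → i ≡ j
  t-injective′ eq = proj₂ (t-injective eq)

  module _ (few : ∀ {x y} → x ≢ y → ∀ {k} (S : Subset k) (v : Fin k → Fin n) → Injective _≡_ _≡_ v →
                  (∀ {i} → i ∈ S → Shared x y (v i)) → ∣ S ∣ ≤ 2) where

    no-three : ∀ {x y u v w} → x ≢ y → Shared x y u → Shared x y v → Shared x y w →
               u ≢ v → u ≢ w → v ≢ w → ⊥
    no-three {u = u} {v} {w} x≢y su sv sw u≢v u≢w v≢w = contradiction
      (few x≢y (⊤ {3}) (lookup (u ∷ v ∷ w ∷ [])) inj λ {i} _ → sh i) (ℕ.<⇒≱ (s≤s (s≤s (s≤s z≤n))))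
      where
      inj : Injective _≡_ _≡_ (lookup (u ∷ v ∷ w ∷ []))
      inj {0F} {0F} _  = refl
      inj {0F} {1F} eq = contradiction eq u≢v
      inj {0F} {2F} eq = contradiction eq u≢w
      inj {1F} {0F} eq = contradiction (sym eq) u≢v
      inj {1F} {1F} _  = refl
      inj {1F} {2F} eq = contradiction eq v≢w
      inj {2F} {0F} eq = contradiction (sym eq) u≢w
      inj {2F} {1F} eq = contradiction (sym eq) v≢w
      inj {2F} {2F} _  = refl
      sh : ∀ i → Shared _ _ (lookup (u ∷ v ∷ w ∷ []) i)
      sh 0F = su
      sh 1F = sv
      sh 2F = sw

    -- With side d of hexagon Y fixed, Q a b lists the passes of a circulation for the
    -- sides a of X and b of Z.
    module WithSideFixed {Y X Z : Fin 3} (Y≢X : Y ≢ X) (Y≢Z : Y ≢ Z) (X≢Z : X ≢ Z)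
             (cover : ∀ x → x ≡ Y ⊎ x ≡ X ⊎ x ≡ Z)
             (d : Bool) (c : Bool → Bool → Fin 3 → Bool)
             (cY : ∀ a b → c a b Y ≡ d) (cX : ∀ a b → c a b X ≡ a) (cZ : ∀ a b → c a b Z ≡ b)
             (circ : ∀ a b → Circulation (c a b))
             (unique : ∀ {i j} → (∃[ x ] ∃[ k ] t x k ≡ s Y i) → (∃[ x ] ∃[ k ] t Y (π d i) ≡ s x k) →
                                 (∃[ x ] ∃[ k ] t x k ≡ s Y j) → (∃[ x ] ∃[ k ] t Y (π d j) ≡ s x k) → i ≡ j)
             where

      Q : Bool → Bool → Fin 3 → Fin 3 → Set
      Q a b = Circulation.Pass (circ a b)

      forth : ∀ {a b x i e} → c a b x ≡ e → Q a b x i → ∃[ y ] ∃[ j ] y ≢ x × Q a b y j × t x (π e i) ≡ s y j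
      forth {a} {b} {x} {i} refl p = let y , j , q , eq = Circulation.forth (circ a b) p in
        y , j , (λ y≡x → s≢t _ _ _ (sym (subst (λ z → t x (π (c a b x) i) ≡ s z j) y≡x eq))) , q , eq

      back : ∀ {a b x i} → Q a b x i → ∃[ y ] ∃[ j ] y ≢ x × Q a b y j × t y (π (c a b y) j) ≡ s x i
      back {a} {b} {x} {i} p = let y , j , q , eq = Circulation.back (circ a b) p in
        y , j , (λ y≡x → s≢t _ _ _ (sym (subst (λ z → t z (π (c a b y) j) ≡ s x i) y≡x eq))) , q , eq

      forthX : ∀ {a b i} → Q a b X i → (∃[ k ] Q a b Z k × t X (π a i) ≡ s Z k)
                                     ⊎ (∃[ k ] Q a b Y k × t X (π a i) ≡ s Y k)
      forthX p with forth (cX _ _) p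
      ... | y , j , y≢ , q , eq with cover y
      ... | inj₁ refl        = inj₂ (j , q , eq)
      ... | inj₂ (inj₁ refl) = contradiction refl y≢
      ... | inj₂ (inj₂ refl) = inj₁ (j , q , eq)

      forthZ : ∀ {a b i} → Q a b Z i → (∃[ k ] Q a b X k × t Z (π b i) ≡ s X k)
                                     ⊎ (∃[ k ] Q a b Y k × t Z (π b i) ≡ s Y k)
      forthZ p with forth (cZ _ _) p
      ... | y , j , y≢ , q , eq with cover y
      ... | inj₁ refl        = inj₂ (j , q , eq)
      ... | inj₂ (inj₁ refl) = inj₁ (j , q , eq)
      ... | inj₂ (inj₂ refl) = contradiction refl y≢

      forthY : ∀ {a b i} → Q a b Y i → (∃[ k ] Q a b X k × t Y (π d i) ≡ s X k)
                                     ⊎ (∃[ k ] Q a b Z k × t Y (π d i) ≡ s Z k)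
      forthY p with forth (cY _ _) p
      ... | y , j , y≢ , q , eq with cover y
      ... | inj₁ refl        = contradiction refl y≢
      ... | inj₂ (inj₁ refl) = inj₁ (j , q , eq)
      ... | inj₂ (inj₂ refl) = inj₂ (j , q , eq)

      backY : ∀ {a b i} → Q a b Y i → (∃[ k ] t X k ≡ s Y i) ⊎ (∃[ k ] t Z k ≡ s Y i)
      backY p with back p
      ... | y , j , y≢ , q , eq with cover y
      ... | inj₁ refl        = contradiction refl y≢
      ... | inj₂ (inj₁ refl) = inj₁ (_ , eq)
      ... | inj₂ (inj₂ refl) = inj₂ (_ , eq)

      backX : ∀ {a b i} → Q a b X i → (∃[ k ] Q a b Y k × t Y (π d k) ≡ s X i) ⊎ (∃[ k ] t Z k ≡ s X i)
      backX {a} {b} p with back p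
      ... | y , j , y≢ , q , eq with cover y
      ... | inj₁ refl        = inj₁ (_ , q , trans (cong (λ e → t Y (π e j)) (sym (cY a b))) eq)
      ... | inj₂ (inj₁ refl) = contradiction refl y≢
      ... | inj₂ (inj₂ refl) = inj₂ (_ , eq)

      -- Entering and leaving Y makes both ends of the traversed arc shared, so `unique` leaves one
      -- candidate. The two passes may belong to different circulations, which is what allows these
      -- to be compared.
      uniqueY : ∀ {a b i a′ b′ i′} → Q a b Y i → Q a′ b′ Y i′ → i ≡ i′
      uniqueY p p′ = unique (entered p) (left p) (entered p′) (left p′)
        where
        entered : ∀ {a b i} → Q a b Y i → ∃[ x ] ∃[ k ] t x k ≡ s Y i
        entered p = let x , k , _ , _ , eq = back p in x , _ , eq
        left : ∀ {a b i} → Q a b Y i → ∃[ x ] ∃[ k ] t Y (π d i) ≡ s x k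
        left p = let x , k , _ , _ , eq = forth (cY _ _) p in x , k , eq

      -- Here Y is crossed from Z back to Z, so a circulation can enter X only from Z and leave it
      -- only to Z.
      module FromZToZ (via : ∀ {a b i} → Q a b Y i → (∃[ k ] t Z k ≡ s Y i) × (∃[ k ] t Y (π d i) ≡ s Z k)) where

        enteredX : ∀ {a b i} → Q a b X i → Shared X Z (s X i)
        enteredX p with backX p
        ... | inj₁ (_ , q , eq) = contradiction (proj₁ (s-injective (trans (sym eq) (proj₂ (proj₂ (via q)))))) X≢Z
        ... | inj₂ (k , eq)     = inj₂ (_ , _ , refl , eq)

        leftX : ∀ {a b i} → Q a b X i → Shared X Z (t X (π a i))
        leftX p with forthX p
        ... | inj₁ (k , _ , eq) = inj₁ (_ , _ , refl , sym eq)
        ... | inj₂ (_ , q , eq) = contradiction (proj₁ (t-injective (trans eq (sym (proj₂ (proj₁ (via q))))))) X≢Z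

        -- All starts and ends of X in use are shared with Z. One start with the ends that the two
        -- sides reach from it, or two starts with one end, would be three shared vertices.
        not-both : ∀ {b i b′ j} → Q true b X i → Q false b′ X j → ⊥
        not-both {i = i} {j = j} p q with i Fin.≟ j
        ... | yes refl = no-three X≢Z (enteredX p) (leftX p) (leftX q) (s≢t _ _ _) (s≢t _ _ _)
                           (λ eq → π-distinct i (t-injective′ eq))
        ... | no  i≢j  = no-three X≢Z (enteredX p) (enteredX q) (leftX p) (λ eq → i≢j (s-injective′ eq))
                           (s≢t _ _ _) (s≢t _ _ _)

        -- Without X a circulation alternates between Y and Z, and by `uniqueY` it returns to the
        -- very arc of Y that it left.
        around : ∀ a → (∀ {b i} → ¬ Q a b X i) → ∀ b → ∃[ l ] Q a b Y l × ∃[ k ] t Y (π d l) ≡ s Z k × t Z (π b k) ≡ s Y l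
        around a noX b = fromSome (Circulation.some (circ a b))
          where
          fromY : ∀ {l} → Q a b Y l → _
          fromY {l} p with forthY p
          ... | inj₁ (_ , q , _)  = contradiction q noX
          ... | inj₂ (k , q , eq) with forthZ q
          ... | inj₁ (_ , r , _)   = contradiction r noX
          ... | inj₂ (m , r , eq′) = l , p , k , eq , trans eq′ (cong (s Y) (uniqueY r p))
          fromZ : ∀ {l} → Q a b Z l → _
          fromZ p with forthZ p
          ... | inj₁ (_ , r , _) = contradiction r noX
          ... | inj₂ (_ , r , _) = fromY r
          fromSome : (∃[ x ] ∃[ i ] Q a b x i) → _
          fromSome (x , i , p) with cover x
          ... | inj₁ refl        = fromY p
          ... | inj₂ (inj₁ refl) = contradiction p noX
          ... | inj₂ (inj₂ refl) = fromZ p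

        -- Both sides of Z would lead from the end of the one usable arc of Y to its start, giving Z
        -- two arcs with the same start and end.
        avoidX : ∀ a → (∀ {b i} → ¬ Q a b X i) → ⊥
        avoidX a noX with around a noX true | around a noX false
        ... | l , p , k , eq₁ , eq₂ | l′ , p′ , k′ , eq₁′ , eq₂′ with uniqueY p p′
        ... | refl with s-injective′ (trans (sym eq₁) eq₁′)
        ... | refl = π-distinct k (t-injective′ (trans eq₂ (sym eq₂′)))

        impossible : ⊥
        impossible = avoidX false λ q → avoidX true λ p → not-both p q

      -- Here Y is crossed from X to Z, if at all. Every circulation then runs from X to Z, directly
      -- or through Y, and from Z straight back to X.
      module FromXToZ (via : ∀ {a b i} → Q a b Y i → (∃[ k ] t X k ≡ s Y i) × (∃[ k ] t Y (π d i) ≡ s Z k)) where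

        EnteredFromZ : Fin 3 → Set
        EnteredFromZ i = ∃[ k ] t Z k ≡ s X i

        enteredX : ∀ {a b i} → Q a b X i → EnteredFromZ i
        enteredX p with backX p
        ... | inj₁ (_ , q , eq) = contradiction (proj₁ (s-injective (trans (sym eq) (proj₂ (proj₂ (via q)))))) X≢Z
        ... | inj₂ k            = k

        leftZ : ∀ {a b k} → Q a b Z k → ∃[ i ] Q a b X i × t Z (π b k) ≡ s X i
        leftZ p with forthZ p
        ... | inj₁ q            = q
        ... | inj₂ (_ , q , eq) = contradiction (proj₁ (t-injective (trans (proj₂ (proj₁ (via q))) (sym eq)))) X≢Z

        someX : ∀ a b → ∃[ i ] Q a b X i
        someX a b = fromSome (Circulation.some (circ a b))
          where
          fromZ : ∀ {k} → Q a b Z k → _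
          fromZ p = let i , q , _ = leftZ p in i , q
          fromSome : (∃[ x ] ∃[ i ] Q a b x i) → _
          fromSome (x , i , p) with cover x
          ... | inj₂ (inj₁ refl) = i , p
          ... | inj₂ (inj₂ refl) = fromZ p
          ... | inj₁ refl with forthY p
          ... | inj₁ (_ , q , _) = _ , q
          ... | inj₂ (_ , q , _) = fromZ q

        -- The two ways from X to Z. The side of Z is held at `true`, so that circulations for both
        -- sides of X leave Z along arcs of the same side.
        Direct Indirect : Bool → Fin 3 → Fin 3 → Set
        Direct   a i k = t X (π a i) ≡ s Z k
        Indirect a i k = ∃[ l ] Q a true Y l × t X (π a i) ≡ s Y l × t Y (π d l) ≡ s Z k

        hop : ∀ {a i} → Q a true X i → ∃[ k ] Q a true Z k × (Direct a i k ⊎ Indirect a i k)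
        hop p with forthX p
        ... | inj₁ (k , q , eq) = k , q , inj₁ eq
        ... | inj₂ (l , q , eq) with forthY q
        ... | inj₁ (_ , _ , eq′) = contradiction (proj₁ (s-injective (trans (sym eq′) (proj₂ (proj₂ (via q)))))) X≢Z
        ... | inj₂ (k , r , eq′) = k , r , inj₂ (l , q , eq , eq′)

        OneEntry : Set
        OneEntry = ∀ {i j} → EnteredFromZ i → EnteredFromZ j → i ≡ j

        -- A direct hop already uses one vertex shared by X and Z; two different entries would bring
        -- the number to three.
        direct⇒oneEntry : ∀ {a i k} → Direct a i k → OneEntry
        direct⇒oneEntry eq {i} {j} (_ , p) (_ , q) with i Fin.≟ j
        ... | yes i≡j = i≡j
        ... | no  i≢j = ⊥-elim (no-three X≢Z (inj₂ (_ , _ , refl , p)) (inj₂ (_ , _ , refl , q)) (inj₁ (_ , _ , refl , sym eq))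
                          (λ eq → i≢j (s-injective′ eq)) (s≢t _ _ _) (s≢t _ _ _))

        indirect-target : ∀ {a i k a′ i′ k′} → Indirect a i k → Indirect a′ i′ k′ → k ≡ k′
        indirect-target (_ , p , _ , eq) (_ , p′ , _ , eq′) with uniqueY p p′
        ... | refl = s-injective′ (trans (sym eq) eq′)

        not-both-indirect : ∀ {i k k′} → Indirect true i k → Indirect false i k′ → ⊥
        not-both-indirect {i} (_ , p , eq , _) (_ , p′ , eq′ , _) with uniqueY p p′
        ... | refl = π-distinct i (t-injective′ (trans eq (sym eq′)))

        -- Both sides of X set out from the only entry, and Z returns both to it. Since Z uses the
        -- same side, both entered Z at the same start. Two direct hops, or two hops through Y,
        -- would give X two arcs with the same start and end; one hop of each kind would make a
        -- vertex an end of both X and Y.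
        oneEntry-impossible : OneEntry → ⊥
        oneEntry-impossible one with someX true true | someX false true
        ... | i , p | j , q with one (enteredX p) (enteredX q)
        ... | refl with hop p | hop q
        ... | k , p′ , m | l , q′ , m′ with leftZ p′ | leftZ q′
        ... | _ , p″ , eq | _ , q″ , eq′ with one (enteredX p″) (enteredX q″)
        ... | refl with t-injective′ (trans eq (sym eq′))
        ... | refl with m | m′
        ... | inj₁ e               | inj₁ e′               = π-distinct i (t-injective′ (trans e (sym e′)))
        ... | inj₁ e               | inj₂ (_ , _ , _ , e′) = Y≢X (proj₁ (t-injective (trans e′ (sym e))))
        ... | inj₂ (_ , _ , _ , e) | inj₁ e′               = Y≢X (proj₁ (t-injective (trans e (sym e′))))
        ... | inj₂ e               | inj₂ e′               = not-both-indirect e e′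

        -- A direct hop leaves only one entry. Two indirect hops use the same arc of Y and so enter
        -- Z at the same start; after one turn both circulations stand at the same start of X, from
        -- which its two sides cannot both lead to that arc of Y.
        impossible : ⊥
        impossible with someX true true | someX false true
        ... | i , p | j , q with hop p | hop q
        ... | _ , _ , inj₁ e | _              = oneEntry-impossible (direct⇒oneEntry {true} {i} e)
        ... | _ , _ , inj₂ _ | _ , _ , inj₁ e = oneEntry-impossible (direct⇒oneEntry {false} {j} e)
        ... | k , p′ , inj₂ e | l , q′ , inj₂ e′ with indirect-target e e′
        ... | refl with leftZ p′ | leftZ q′
        ... | i′ , p″ , eq | j′ , q″ , eq′ with s-injective′ (trans (sym eq) eq′)
        ... | refl with hop p″ | hop q″
        ... | _ , _ , inj₁ e″ | _               = oneEntry-impossible (direct⇒oneEntry {true} {i′} e″)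
        ... | _ , _ , inj₂ _  | _ , _ , inj₁ e″ = oneEntry-impossible (direct⇒oneEntry {false} {i′} e″)
        ... | _ , _ , inj₂ e₁ | _ , _ , inj₂ e₂ = not-both-indirect e₁ e₂

    all-circulate-impossible : ¬ (∀ c → Circulation (lookup c))
    all-circulate-impossible circ =
      let d , one = some-side-has-at-most-one-connection U ∣U∣≤4 in
      Conclusion.impossible d
          (λ {i} {j} p q p′ q′ → one i j (entered∈U i p , left∈U (π d i) q) (entered∈U j p′ , left∈U (π d j) q′))
      where
      Y X Z : Fin 3
      Y = 0F
      X = 1F
      Z = 2F
      0≢1 : Y ≢ X
      0≢1 ()
      0≢2 : Y ≢ Z
      0≢2 ()
      1≢2 : X ≢ Z
      1≢2 ()
      2≢1 : Z ≢ X
      2≢1 ()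
      vertex : Fin 6 → Fin n
      vertex = [ s Y , t Y ]′ ∘ splitAt 3
      vertex-injective : Injective _≡_ _≡_ vertex
      vertex-injective {a} {b} eq with splitAt 3 a in eqa | splitAt 3 b in eqb
      ... | inj₁ i | inj₁ j = trans (sym (Fin.splitAt⁻¹-↑ˡ {3} {i = a} eqa))
          (trans (cong (_↑ˡ 3) (s-injective′ eq)) (Fin.splitAt⁻¹-↑ˡ {3} {i = b} eqb))
      ... | inj₁ i | inj₂ j = contradiction eq (s≢t _ _ _)
      ... | inj₂ i | inj₁ j = contradiction (sym eq) (s≢t _ _ _)
      ... | inj₂ i | inj₂ j = trans (sym (Fin.splitAt⁻¹-↑ʳ {3} {i = a} eqa))
          (trans (cong (3 ↑ʳ_) (t-injective′ eq)) (Fin.splitAt⁻¹-↑ʳ {3} {i = b} eqb))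
      sharedWith : Fin 3 → Subset 6
      sharedWith x = ⟦ (λ k → shared? Y x (vertex k)) ⟧
      U : Subset 6
      U = sharedWith X ∪ sharedWith Z
      sharedX∈U : ∀ k → Shared Y X (vertex k) → k ∈ U
      sharedX∈U k sh = x∈p∪q⁺ {p = sharedWith X} {q = sharedWith Z} (inj₁ (∈⟦⟧⁺ (shared? Y X ∘ vertex) sh))
      sharedZ∈U : ∀ k → Shared Y Z (vertex k) → k ∈ U
      sharedZ∈U k sh = x∈p∪q⁺ {p = sharedWith X} {q = sharedWith Z} (inj₂ (∈⟦⟧⁺ (shared? Y Z ∘ vertex) sh))
      start : ∀ i → s Y i ≡ vertex (i ↑ˡ 3)
      start i = sym (cong [ s Y , t Y ]′ (Fin.splitAt-↑ˡ 3 i 3))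
      ∣U∣≤4 : ∣ U ∣ ≤ 4
      ∣U∣≤4 = ℕ.≤-trans (∣p∪q∣≤∣p∣+∣q∣ (sharedWith X) (sharedWith Z))
        (ℕ.+-mono-≤ (few 0≢1 _ vertex vertex-injective (∈⟦⟧⁻ (shared? Y X ∘ vertex)))
            (few 0≢2 _ vertex vertex-injective (∈⟦⟧⁻ (shared? Y Z ∘ vertex))))
      entered∈U : ∀ i → (∃[ x ] ∃[ k ] t x k ≡ s Y i) → i ↑ˡ 3 ∈ U
      entered∈U i (0F , k , eq) = contradiction (sym eq) (s≢t Y i k)
      entered∈U i (1F , k , eq) = sharedX∈U (i ↑ˡ 3) (inj₂ (i , k , start i , trans eq (start i)))
      entered∈U i (2F , k , eq) = sharedZ∈U (i ↑ˡ 3) (inj₂ (i , k , start i , trans eq (start i)))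
      left∈U : ∀ i → (∃[ x ] ∃[ k ] t Y i ≡ s x k) → 3 ↑ʳ i ∈ U
      left∈U i (0F , k , eq) = contradiction (sym eq) (s≢t Y k i)
      left∈U i (1F , k , eq) = sharedX∈U (3 ↑ʳ i) (inj₁ (i , k , refl , sym eq))
      left∈U i (2F , k , eq) = sharedZ∈U (3 ↑ʳ i) (inj₁ (i , k , refl , sym eq))
      module Conclusion (d : Bool)
        (unique : ∀ {i j} → (∃[ x ] ∃[ k ] t x k ≡ s Y i) → (∃[ x ] ∃[ k ] t Y (π d i) ≡ s x k) →
                            (∃[ x ] ∃[ k ] t x k ≡ s Y j) → (∃[ x ] ∃[ k ] t Y (π d j) ≡ s x k) → i ≡ j)
        where
        c : Bool → Bool → Fin 3 → Bool
        c a b = lookup (d ∷ a ∷ b ∷ [])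
        cY : ∀ a b → c a b Y ≡ d
        cY _ _ = refl
        cX : ∀ a b → c a b X ≡ a
        cX _ _ = refl
        cZ : ∀ a b → c a b Z ≡ b
        cZ _ _ = refl
        cover : ∀ x → x ≡ Y ⊎ x ≡ X ⊎ x ≡ Z
        cover 0F = inj₁ refl
        cover 1F = inj₂ (inj₁ refl)
        cover 2F = inj₂ (inj₂ refl)
        cover′ : ∀ x → x ≡ Y ⊎ x ≡ Z ⊎ x ≡ X
        cover′ 0F = inj₁ refl
        cover′ 1F = inj₂ (inj₂ refl)
        cover′ 2F = inj₂ (inj₁ refl)
        module M = WithSideFixed 0≢1 0≢2 1≢2 cover d c cY cX cZ (λ a b → circ (d ∷ a ∷ b ∷ [])) unique
        -- Exchanging X and Z reduces the four possible pairs of neighbours of the crossing arc to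
        -- the two cases treated above.
        module M′ = WithSideFixed 0≢2 0≢1 2≢1 cover′ d (λ a b → c b a) (λ a b → cY b a) (λ a b → cZ b a)
                      (λ a b → cX b a) (λ a b → circ (d ∷ b ∷ a ∷ [])) unique
        -- A single crossing of Y determines the neighbours of all crossings, in every circulation,
        -- because they use the same arc.
        noY : ∀ {a b i} → ¬ M.Q a b Y i
        noY {a} {b} {i} p with M.backY p | M.forthY p
        ... | inj₁ (k , e) | inj₁ (l , _ , e′) = M′.FromZToZ.impossible λ q → via (M.uniqueY p q)
          where via : ∀ {j} → i ≡ j → (∃[ k ] t X k ≡ s Y j) × (∃[ k ] t Y (π d j) ≡ s X k)
                via refl = (k , e) , (l , e′)
        ... | inj₁ (k , e) | inj₂ (l , _ , e′) = M.FromXToZ.impossible λ q → via (M.uniqueY p q)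
          where via : ∀ {j} → i ≡ j → (∃[ k ] t X k ≡ s Y j) × (∃[ k ] t Y (π d j) ≡ s Z k)
                via refl = (k , e) , (l , e′)
        ... | inj₂ (k , e) | inj₁ (l , _ , e′) = M′.FromXToZ.impossible λ q → via (M.uniqueY p q)
          where via : ∀ {j} → i ≡ j → (∃[ k ] t Z k ≡ s Y j) × (∃[ k ] t Y (π d j) ≡ s X k)
                via refl = (k , e) , (l , e′)
        ... | inj₂ (k , e) | inj₂ (l , _ , e′) = M.FromZToZ.impossible λ q → via (M.uniqueY p q)
          where via : ∀ {j} → i ≡ j → (∃[ k ] t Z k ≡ s Y j) × (∃[ k ] t Y (π d j) ≡ s Z k)
                via refl = (k , e) , (l , e′)
        impossible : ⊥
        -- No circulation crosses Y, so the assumption of this case holds vacuously.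
        impossible = M.FromXToZ.impossible (λ p → ⊥-elim (noY p))

-- Counting in finite sets, first repetitions and cyclic indices.

⟦⟧-cong : ∀ {n} {P Q : Pred (Fin n) 0ℓ} (P? : Decidable P) (Q? : Decidable Q) →
          (∀ i → P i ⇔ Q i) → ⟦ P? ⟧ ≡ ⟦ Q? ⟧
⟦⟧-cong P? Q? P⇔Q = tabulate-cong λ i → does-⇔ (P⇔Q i) (P? i) (Q? i)

∣p∣≡0⇒∉ : ∀ {n} (p : Subset n) → ∣ p ∣ ≡ 0 → ∀ x → x ∉ p
∣p∣≡0⇒∉ (outside ∷ p) eq (suc x) (there x∈p) = ∣p∣≡0⇒∉ p eq x x∈p

∣p∣≡1⇒singleton : ∀ {n} (p : Subset n) → ∣ p ∣ ≡ 1 → ∃[ x ] x ∈ p × ∀ {y} → y ∈ p → y ≡ x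
∣p∣≡1⇒singleton (inside ∷ p) eq = zero , here , λ where
  here          → refl
  (there y∈p) → contradiction y∈p (∣p∣≡0⇒∉ p (ℕ.suc-injective eq) _)
∣p∣≡1⇒singleton (outside ∷ p) eq = let x , x∈p , only = ∣p∣≡1⇒singleton p eq in
  suc x , there x∈p , λ { (there y∈p) → cong suc (only y∈p) }

∣p∣≡2⇒pair : ∀ {n} (p : Subset n) → ∣ p ∣ ≡ 2 →
             ∃[ x ] ∃[ y ] x ≢ y × x ∈ p × y ∈ p × ∀ {z} → z ∈ p → z ≡ x ⊎ z ≡ y
∣p∣≡2⇒pair (inside ∷ p) eq = let y , y∈p , only = ∣p∣≡1⇒singleton p (ℕ.suc-injective eq) in
  zero , suc y , (λ ()) , here , there y∈p , λ where
    here        → inj₁ refl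
    (there z∈p) → inj₂ (cong suc (only z∈p))
∣p∣≡2⇒pair (outside ∷ p) eq = let x , y , x≢y , x∈p , y∈p , only = ∣p∣≡2⇒pair p eq in
  suc x , suc y , x≢y ∘ Fin.suc-injective , there x∈p , there y∈p ,
  λ { (there z∈p) → [ inj₁ ∘ cong suc , inj₂ ∘ cong suc ]′ (only z∈p) }

∣p∣≡2⇒other : ∀ {n} (p : Subset n) → ∣ p ∣ ≡ 2 → ∀ {x} → x ∈ p →
              ∃[ y ] y ∈ p × y ≢ x × ∀ {z} → z ∈ p → z ≡ x ⊎ z ≡ y
∣p∣≡2⇒other p eq x∈p with ∣p∣≡2⇒pair p eq
... | a , b , a≢b , a∈p , b∈p , only with only x∈p
... | inj₁ refl = b , b∈p , a≢b ∘ sym , only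
... | inj₂ refl = a , a∈p , a≢b , λ z∈p → [ inj₂ , inj₁ ]′ (only z∈p)

injection⇒∣p∣≤∣q∣ : ∀ {k n} (p : Subset k) (q : Subset n) (f : Fin k → Fin n) → Injective _≡_ _≡_ f →
                    (∀ {i} → i ∈ p → f i ∈ q) → ∣ p ∣ ≤ ∣ q ∣
injection⇒∣p∣≤∣q∣ [] q f inj f∈ = z≤n
injection⇒∣p∣≤∣q∣ (outside ∷ p) q f inj f∈ =
  injection⇒∣p∣≤∣q∣ p q (f ∘ suc) (Fin.suc-injective ∘ inj) (f∈ ∘ there)
injection⇒∣p∣≤∣q∣ (inside ∷ p) q f inj f∈ = ℕ.≤-<-trans
  (injection⇒∣p∣≤∣q∣ p (q - f zero) (f ∘ suc) (Fin.suc-injective ∘ inj)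
    (λ i∈p → x∈p∧x≢y⇒x∈p-y (f∈ (there i∈p)) (λ eq → Fin.0≢1+n (sym (inj eq)))))
  (x∈p⇒∣p-x∣<∣p∣ (f∈ here))

-- Distinctness before `j` makes `j` the earliest repetition; it is what makes the closed walks
-- built from it simple.
record FirstRepetition {m} (w : ℕ → Fin m) : Set where
  field
    {i j}    : ℕ
    i<j      : i < j
    repeated : w i ≡ w j
    distinct : ∀ {a b} → a < j → b < j → w a ≡ w b → a ≡ b

firstRepetition : ∀ {m} (w : ℕ → Fin m) → FirstRepetition w
firstRepetition {m} w with search (suc m)
  where
  Distinct : ℕ → Set
  Distinct J = ∀ {a b} → a < J → b < J → w a ≡ w b → a ≡ b
  search : ∀ J → FirstRepetition w ⊎ Distinct J
  search zero = inj₂ λ ()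
  search (suc J) with search J
  ... | inj₁ found = inj₁ found
  ... | inj₂ distinct with Fin.any? {n = J} (λ i → w (toℕ i) Fin.≟ w J)
  ... | yes (i , eq) = inj₁ record { i<j = Fin.toℕ<n i ; repeated = eq ; distinct = distinct }
  ... | no  none     = inj₂ distinct′
    where
    fresh : ∀ {a} → a < J → w a ≢ w J
    fresh a<J eq = none (fromℕ< a<J , trans (cong w (Fin.toℕ-fromℕ< a<J)) eq)
    distinct′ : Distinct (suc J)
    distinct′ a≤J b≤J eq with ℕ.m≤n⇒m<n∨m≡n (s≤s⁻¹ a≤J) | ℕ.m≤n⇒m<n∨m≡n (s≤s⁻¹ b≤J)
    ... | inj₁ a<J  | inj₁ b<J  = distinct a<J b<J eq
    ... | inj₁ a<J  | inj₂ refl = contradiction eq (fresh a<J)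
    ... | inj₂ refl | inj₁ b<J  = contradiction (sym eq) (fresh b<J)
    ... | inj₂ refl | inj₂ refl = refl
... | inj₁ found    = found
... | inj₂ distinct = contradiction
  (Fin.injective⇒≤ {f = λ (i : Fin (suc m)) → w (toℕ i)}
    (λ {a} {b} eq → Fin.toℕ-injective (distinct (Fin.toℕ<n a) (Fin.toℕ<n b) eq)))
  ℕ.1+n≰n

toℕ-next : ∀ {k} (i : Fin k) → (suc (toℕ i) < k × toℕ (next i) ≡ suc (toℕ i))
                             ⊎ (suc (toℕ i) ≡ k × toℕ (next i) ≡ 0)
toℕ-next {suc k} i with ℕ.m≤n⇒m<n∨m≡n (Fin.toℕ<n i)
... | inj₁ lt = inj₁ (lt , trans (Fin.toℕ-fromℕ< (m%n<n (suc (toℕ i)) (suc k))) (m<n⇒m%n≡m lt))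
... | inj₂ eq = inj₂ (eq , trans (Fin.toℕ-fromℕ< (m%n<n (suc (toℕ i)) (suc k)))
                             (trans (cong (_% suc k) eq) (n%n≡0 (suc k))))

-- Going up from `i` reaches the last index, one more step wraps around to 0, and going up again
-- reaches every index.
next-induction : ∀ {k} {P : Fin k → Set} → (∀ i → P i → P (next i)) → ∀ {i} → P i → ∀ j → P j
next-induction {k} {P} step {i} Pi j = up (toℕ j) at-zero j (sym (ℕ.+-identityʳ (toℕ j)))
  where
  At : ℕ → Set
  At a = ∀ i → toℕ i ≡ a → P i
  at-suc : ∀ {a} → At a → At (suc a)
  at-suc {a} Pa i eq with toℕ-next (fromℕ< a<k)
    where a<k = ℕ.<-trans (ℕ.n<1+n a) (subst (_< k) eq (Fin.toℕ<n i))
  ... | inj₁ (_ , eq′) = subst P (Fin.toℕ-injective (trans eq′ (trans (cong suc (Fin.toℕ-fromℕ< _)) (sym eq))))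
                           (step _ (Pa _ (Fin.toℕ-fromℕ< _)))
  ... | inj₂ (eq′ , _) = contradiction (trans eq (trans (sym (cong suc (Fin.toℕ-fromℕ< _))) eq′)) (ℕ.<⇒≢ (Fin.toℕ<n i))
  up : ∀ d {a} → At a → At (d + a)
  up zero    Pa = Pa
  up (suc d) Pa = at-suc (up d Pa)
  at-i : At (toℕ i)
  at-i i′ eq = subst P (sym (Fin.toℕ-injective eq)) Pi
  at-zero : At 0
  at-zero i′ eq with up (k ∸ suc (toℕ i)) at-i
  ... | at-last with fromℕ< {k ∸ suc (toℕ i) + toℕ i} (ℕ.≤-reflexive last) in eq′
    where
    last : suc (k ∸ suc (toℕ i) + toℕ i) ≡ k
    last = trans (sym (ℕ.+-suc _ _)) (ℕ.m∸n+n≡m (Fin.toℕ<n i))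
  ... | l with toℕ-next l | trans (cong toℕ (sym eq′)) (Fin.toℕ-fromℕ< _)
  ... | inj₁ (lt , _)   | toℕl = contradiction (trans (cong suc toℕl) (trans (sym (ℕ.+-suc _ _)) (ℕ.m∸n+n≡m (Fin.toℕ<n i)))) (ℕ.<⇒≢ lt)
  ... | inj₂ (_ , eq″)  | toℕl = subst P (Fin.toℕ-injective (trans eq″ (sym eq))) (step l (at-last l toℕl))

next-surjective : ∀ {k} (i : Fin k) → ∃[ j ] next j ≡ i
next-surjective i = next-induction {P = λ i → ∃[ j ] next j ≡ i} (λ i _ → i , refl) (i , refl) i

-- Cycle covers, and cycles as reachability classes.

NextArc : (K : Digraph) → Fin (m K) → Fin (m K) → Set
NextArc K e e′ = e ∈ A K × e′ ∈ A K × tgt K e ≡ src K e′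

Reach : (K : Digraph) → Fin (m K) → Fin (m K) → Set
Reach K = Star (NextArc K)

-- Every arc has exactly one successor and no two arcs share theirs, so succession is a permutation
-- of a finite set whose orbits are the cycles.
record CycleCover (K : Digraph) : Set where
  field
    after         : ∀ {e} → e ∈ A K → ∃[ e′ ] e′ ∈ A K × tgt K e ≡ src K e′
    src-injective : ∀ {e e′} → e ∈ A K → e′ ∈ A K → src K e ≡ src K e′ → e ≡ e′
    tgt-injective : ∀ {e e′} → e ∈ A K → e′ ∈ A K → tgt K e ≡ tgt K e′ → e ≡ e′

  Through : Cycle K → Fin (m K) → Set
  Through C e = ∃[ i ] Cycle.arc C i ≡ e

  -- Succession is injective, so a repetition at a positive index could be pulled back by one step;
  -- the first repetition is therefore a return to `e`.
  cycleThrough : ∀ {e} → e ∈ A K → Σ (Cycle K) λ C → Through C e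
  cycleThrough {e} e∈A = build (firstRepetition arcAt)
    where
    walk : ℕ → ∃[ e ] e ∈ A K
    walk zero    = e , e∈A
    walk (suc k) = let e′ , e′∈A , _ = after (proj₂ (walk k)) in e′ , e′∈A
    arcAt : ℕ → Fin (m K)
    arcAt = proj₁ ∘ walk
    step : ∀ k → tgt K (arcAt k) ≡ src K (arcAt (suc k))
    step k = proj₂ (proj₂ (after (proj₂ (walk k))))
    build : FirstRepetition arcAt → _
    build r with FirstRepetition.i r | FirstRepetition.j r | FirstRepetition.i<j r | FirstRepetition.repeated r | FirstRepetition.distinct r
    ... | suc i | suc j | i<j | eq | distinct = contradiction
      (distinct (ℕ.<-trans (ℕ.n<1+n i) (i<j)) (ℕ.n<1+n j)
        (tgt-injective (proj₂ (walk i)) (proj₂ (walk j)) (trans (step i) (trans (cong (src K) eq) (sym (step j))))))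
      (λ { refl → ℕ.<-irrefl refl i<j })
    ... | zero | suc j | i<j | eq | distinct = record
      { len         = suc j
      ; arc         = arcAt ∘ toℕ
      ; arc∈        = λ i → proj₂ (walk (toℕ i))
      ; consecutive = consecutive
      ; simple      = λ {a} {b} eq → Fin.toℕ-injective (distinct (Fin.toℕ<n a) (Fin.toℕ<n b)
                        (src-injective (proj₂ (walk (toℕ a))) (proj₂ (walk (toℕ b))) eq))
      } , zero , refl
      where
      consecutive : ∀ (i : Fin (suc j)) → tgt K (arcAt (toℕ i)) ≡ src K (arcAt (toℕ (next i)))
      consecutive i with toℕ-next i
      ... | inj₁ (_ , eq′)  = trans (step (toℕ i)) (cong (src K ∘ arcAt) (sym eq′))
      ... | inj₂ (eq″ , eq′) = trans (step (toℕ i)) (cong (src K)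
        (trans (cong arcAt eq″) (trans (sym eq) (cong arcAt (sym eq′)))))

  reach-through : ∀ C {e e′} → Through C e → Reach K e e′ → Through C e′
  reach-through C on ε = on
  reach-through C (i , refl) ((_ , e′∈A , eq) ◅ r) = reach-through C
    (next i , src-injective (Cycle.arc∈ C (next i)) e′∈A (trans (sym (Cycle.consecutive C i)) eq)) r

  through-reach : ∀ C {e e′} → Through C e → Through C e′ → Reach K e e′
  through-reach C (i , refl) (j , refl) = next-induction {P = λ j → Reach K (Cycle.arc C i) (Cycle.arc C j)}
    (λ j r → r ◅◅ (Cycle.arc∈ C j , Cycle.arc∈ C (next j) , Cycle.consecutive C j) ◅ ε) {i} ε j

  -- Whatever an arc reaches lies on the cycle through it, and a cycle leads back.
  reach-sym : ∀ {e e′} → e ∈ A K → Reach K e e′ → Reach K e′ e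
  reach-sym e∈A r = let C , on = cycleThrough e∈A in through-reach C (reach-through C on r) on

  someArc : (C : Cycle K) → ∃ (Through C)
  someArc record { len = suc _ ; arc = arc } = arc zero , zero , refl

  _≈_ : Cycle K → Cycle K → Set
  C ≈ D = SameTerms (Cycle.arc C) (Cycle.arc D)

  reach⇒≈ : ∀ {C D e e′} → Through C e → Through D e′ → Reach K e e′ → C ≈ D
  reach⇒≈ {C} {D} onC onD r a = mk⇔
    (λ on → reach-through D (reach-through D onD (through-reach C (reach-through C onC r) onC)) (through-reach C onC on))
    (λ on → reach-through C (reach-through C onC r) (through-reach D onD on))

  ≈⇒reach : ∀ {C D e e′} → Through C e → Through D e′ → C ≈ D → Reach K e e′
  ≈⇒reach {C} onC onD same = through-reach C onC (Equivalence.from (same _) onD)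

-- Cycles correspond to classes of mutual reachability. The map `f` preserves and reflects
-- reachability, and its image meets every cycle of `K`, so the classes match one to one.
hasCycles-transfer : ∀ {K L k} → CycleCover K → CycleCover L → (f : Fin (m L) → Fin (m K)) →
  (∀ {e} → e ∈ A L → f e ∈ A K) →
  (∀ {e e′} → e ∈ A L → e′ ∈ A L → Reach L e e′ ⇔ Reach K (f e) (f e′)) →
  ((C : Cycle K) → ∃[ e ] e ∈ A L × ∃[ i ] Cycle.arc C i ≡ f e) →
  HasCycles K k → HasCycles L k
hasCycles-transfer {K} {L} {k} coverK coverL f f∈ reach meets (h , h-inj , h-surj) = Φ ∘ h , inj , surj
  where
  module K = CycleCover coverK
  module L = CycleCover coverL
  rep : Cycle K → Fin (m L)
  rep C = proj₁ (meets C)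
  rep∈ : ∀ C → rep C ∈ A L
  rep∈ C = proj₁ (proj₂ (meets C))
  rep-on : ∀ C → K.Through C (f (rep C))
  rep-on C = proj₂ (proj₂ (meets C))
  Φ : Cycle K → Cycle L
  Φ C = proj₁ (L.cycleThrough (rep∈ C))
  Φ-on : ∀ C → L.Through (Φ C) (rep C)
  Φ-on C = proj₂ (L.cycleThrough (rep∈ C))
  inj : ∀ {a b} → Φ (h a) L.≈ Φ (h b) → a ≡ b
  inj {a} {b} same = h-inj (K.reach⇒≈ {h a} {h b} (rep-on (h a)) (rep-on (h b))
    (Equivalence.to (reach (rep∈ (h a)) (rep∈ (h b))) (L.≈⇒reach {Φ (h a)} {Φ (h b)} (Φ-on (h a)) (Φ-on (h b)) same)))
  surj : ∀ D → ∃[ a ] ∀ {b} → b ≡ a → Φ (h b) L.≈ D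
  surj D with L.someArc D
  ... | e , onD@(i , eq) = a , λ { refl → L.reach⇒≈ {Φ (h a)} {D} (Φ-on (h a)) onD
      (Equivalence.from (reach (rep∈ (h a)) e∈) (K.≈⇒reach {h a} {C} (rep-on (h a)) onC (h-a refl))) }
    where
    e∈ : e ∈ A L
    e∈ = subst (_∈ A L) eq (Cycle.arc∈ D i)
    C : Cycle K
    C = proj₁ (K.cycleThrough (f∈ e∈))
    onC : K.Through C (f e)
    onC = proj₂ (K.cycleThrough (f∈ e∈))
    a : Fin k
    a = proj₁ (h-surj C)
    h-a : ∀ {b} → b ≡ a → h b K.≈ C
    h-a = proj₂ (h-surj C)

-- The starts of the arcs of a cycle are distinct, so its length is at most `n H` and only finitely
-- many arc sequences have to be tried.
hamiltonian? : ∀ H → Dec (Hamiltonian H)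
hamiltonian? H = map′ fromCode toCode (Fin.any? λ l → code? (toℕ l))
  where
  IsHamiltonian : ∀ {k} → (Fin k → Fin (m H)) → Set
  IsHamiltonian arc = (∀ i → arc i ∈ A H) × (∀ i → tgt H (arc i) ≡ src H (arc (next i))) ×
    (∀ i j → src H (arc i) ≡ src H (arc j) → i ≡ j) × (∀ v → v ∈ V H → ∃[ i ] src H (arc i) ≡ v)
  isHamiltonian? : ∀ {k} (arc : Fin k → Fin (m H)) → Dec (IsHamiltonian arc)
  isHamiltonian? arc = (Fin.all? λ i → arc i ∈? A H) ×-dec (Fin.all? λ i → _ Fin.≟ _) ×-dec
    (Fin.all? λ i → Fin.all? λ j → (_ Fin.≟ _) →-dec (_ Fin.≟ _)) ×-dec
    (Fin.all? λ v → (v ∈? V H) →-dec Fin.any? λ i → _ Fin.≟ _)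
  Code : ℕ → Set
  Code l = Σ (Fin (m H ^ suc l)) (λ a → IsHamiltonian (finToFun {m H} {suc l} a))
  code? : ∀ l → Dec (Code l)
  code? l = Fin.any? (λ a → isHamiltonian? (finToFun {m H} {suc l} a))
  fromCode : (∃[ l ] Code (toℕ l)) → Hamiltonian H
  fromCode (l , a , arc∈ , consecutive , simple , spans) =
    record { arc = finToFun a ; arc∈ = arc∈ ; consecutive = consecutive ; simple = simple _ _ } , spans _
  toCode : Hamiltonian H → ∃[ l ] Code (toℕ l)
  toCode (record { len = suc l ; arc = arc ; arc∈ = arc∈ ; consecutive = consecutive ; simple = simple } , spans) =
    fromℕ< l<n , subst Code (sym (Fin.toℕ-fromℕ< l<n)) (funToFin arc ,
      (λ i → subst (_∈ A H) (sym (same i)) (arc∈ i)) ,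
      (λ i → trans (cong (tgt H) (same i)) (trans (consecutive i) (cong (src H) (sym (same (next i)))))) ,
      (λ i j eq → simple (trans (cong (src H) (sym (same i))) (trans eq (cong (src H) (same j))))) ,
      (λ v v∈ → let i , eq = spans v∈ in i , trans (cong (src H) (same i)) eq))
    where
    l<n : l < n H
    l<n = Fin.injective⇒≤ simple
    same : ∀ i → finToFun (funToFin arc) i ≡ arc i
    same = Fin.finToFun-funToFin arc

-- Involutions on the arcs, with alternating cycles as their orbits.

record Mates (G : Digraph) (end : Fin (m G) → Fin (n G)) : Set where
  field
    mate     : Fin (m G) → Fin (m G)
    mate∈    : ∀ {e} → e ∈ A G → mate e ∈ A G
    mate≢    : ∀ {e} → e ∈ A G → mate e ≢ e
    end-mate : ∀ {e} → e ∈ A G → end (mate e) ≡ end e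
    only     : ∀ {e e′} → e ∈ A G → e′ ∈ A G → end e′ ≡ end e → e′ ≡ e ⊎ e′ ≡ mate e

  mate-involutive : ∀ {e} → e ∈ A G → mate (mate e) ≡ e
  mate-involutive e∈ with only e∈ (mate∈ (mate∈ e∈)) (trans (end-mate (mate∈ e∈)) (end-mate e∈))
  ... | inj₁ eq = eq
  ... | inj₂ eq = contradiction eq (mate≢ (mate∈ e∈))

  mate-injective : ∀ {e e′} → e ∈ A G → e′ ∈ A G → mate e ≡ mate e′ → e ≡ e′
  mate-injective e∈ e′∈ eq = trans (sym (mate-involutive e∈)) (trans (cong mate eq) (mate-involutive e′∈))

arcsWithEnd? : ∀ G (end : Fin (m G) → Fin (n G)) v → Decidable (λ e → e ∈ A G × end e ≡ v)
arcsWithEnd? G end v e = (e ∈? A G) ×-dec (end e Fin.≟ v)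

abstract
  mates : ∀ G (end : Fin (m G) → Fin (n G)) →
          (∀ {e} → e ∈ A G → ∣ ⟦ arcsWithEnd? G end (end e) ⟧ ∣ ≡ 2) → Mates G end
  mates G end two = record
    { mate     = λ e → mateOf (e ∈? A G)
    ; mate∈    = λ {e} e∈ → on (λ y → y ∈ A G) (λ e∈ → proj₁ (spec e∈)) e∈ (e ∈? A G)
    ; mate≢    = λ {e} e∈ → on (λ y → y ≢ e) (λ e∈ → proj₁ (proj₂ (proj₂ (spec e∈)))) e∈ (e ∈? A G)
    ; end-mate = λ {e} e∈ → on (λ y → end y ≡ end e) (λ e∈ → proj₁ (proj₂ (spec e∈))) e∈ (e ∈? A G)
    ; only     = λ {e} {e′} e∈ e′∈ eq → on (λ y → e′ ≡ e ⊎ e′ ≡ y) (λ e∈ → proj₂ (proj₂ (proj₂ (spec e∈))) e′∈ eq) e∈ (e ∈? A G)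
    }
    where
    other : ∀ {e} → e ∈ A G → ∃[ y ] y ∈ ⟦ arcsWithEnd? G end (end e) ⟧ × y ≢ e ×
            ∀ {z} → z ∈ ⟦ arcsWithEnd? G end (end e) ⟧ → z ≡ e ⊎ z ≡ y
    other {e} e∈ = ∣p∣≡2⇒other ⟦ arcsWithEnd? G end (end e) ⟧ (two e∈) (∈⟦⟧⁺ (arcsWithEnd? G end (end e)) (e∈ , refl))
    mateOf : ∀ {e} → Dec (e ∈ A G) → Fin (m G)
    mateOf {e} (yes e∈) = proj₁ (other e∈)
    -- A label outside `A G` is made its own mate only to keep the function total.
    mateOf {e} (no  _)  = e
    on : ∀ {e} (P : Fin (m G) → Set) → (∀ (e∈ : e ∈ A G) → P (proj₁ (other e∈))) → e ∈ A G → (d : Dec (e ∈ A G)) → P (mateOf d)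
    on P f e∈ (yes e∈′) = f e∈′
    on P f e∈ (no  e∉)  = contradiction e∈ e∉
    spec : ∀ {e} (e∈ : e ∈ A G) → let y = proj₁ (other e∈) in
           y ∈ A G × end y ≡ end e × y ≢ e × (∀ {z} → z ∈ A G → end z ≡ end e → z ≡ e ⊎ z ≡ y)
    spec {e} e∈ = let _ , y∈ , y≢ , only = other e∈
                      y∈A , eq = ∈⟦⟧⁻ (arcsWithEnd? G end (end e)) y∈ in
      y∈A , eq , y≢ , λ z∈ eq → only (∈⟦⟧⁺ (arcsWithEnd? G end (end e)) (z∈ , eq))

∈verticesOfDegree⁻ : ∀ H d {v} → v ∈ verticesOfDegree H d → v ∈ V H × (indeg H v , outdeg H v) ≡ d
∈verticesOfDegree⁻ H d = ∈⟦⟧⁻ (λ v → (v ∈? V H) ×-dec ≡-dec ℕ._≟_ ℕ._≟_ (indeg H v , outdeg H v) d)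

∈verticesOfDegree⁺ : ∀ H d {v} → v ∈ V H → (indeg H v , outdeg H v) ≡ d → v ∈ verticesOfDegree H d
∈verticesOfDegree⁺ H d v∈ eq = ∈⟦⟧⁺ (λ v → (v ∈? V H) ×-dec ≡-dec ℕ._≟_ ℕ._≟_ (indeg H v , outdeg H v) d) (v∈ , eq)

AC-map : ∀ {H K} (f : Fin (m H) → Fin (m K)) → Injective _≡_ _≡_ f →
  (∀ {e e′} → e ∈ A H → e′ ∈ A H → tgt H e ≡ tgt H e′ → tgt K (f e) ≡ tgt K (f e′)) →
  (∀ {e e′} → e ∈ A H → e′ ∈ A H → src H e ≡ src H e′ → src K (f e) ≡ src K (f e′)) →
  (C : AC H) → (∀ i → f (AC.arc C i) ∈ A K) → AC K
AC-map f f-inj tgt-pres src-pres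
  record { r = r ; arc = arc ; arc∈ = arc∈ ; distinct = distinct ; commonEnd = commonEnd ; commonStart = commonStart } f∈ = record
  { r           = r
  ; arc         = f ∘ arc
  ; arc∈        = f∈
  ; distinct    = distinct ∘ f-inj
  ; commonEnd   = λ i even → tgt-pres (arc∈ i) (arc∈ (next i)) (commonEnd i even)
  ; commonStart = λ i odd → src-pres (arc∈ i) (arc∈ (next i)) (commonStart i odd)
  }

even : ℕ → Bool
even zero    = true
even (suc k) = not (even k)

%2≡0⇒even : ∀ k → k % 2 ≡ 0 → even k ≡ true
%2≡0⇒even zero          eq = refl
%2≡0⇒even (suc (suc k)) eq = trans (not-involutive _) (%2≡0⇒even k eq)

%2≡1⇒odd : ∀ k → k % 2 ≡ 1 → even k ≡ false
%2≡1⇒odd (suc zero)    eq = refl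
%2≡1⇒odd (suc (suc k)) eq = trans (not-involutive _) (%2≡1⇒odd k eq)

even⇒double : ∀ k → even k ≡ true → ∃[ r ] k ≡ 2 * r
even⇒double zero          eq = 0 , refl
even⇒double (suc zero)    ()
even⇒double (suc (suc k)) eq with even k in eq′
... | true = let r , eq″ = even⇒double k eq′ in suc r ,
  trans (cong (2 +_) eq″) (cong suc (sym (ℕ.+-suc r (r + 0))))

not-≢ : ∀ {a b} → a ≢ b → not a ≡ b
not-≢ a≢b = sym (¬-not (a≢b ∘ sym))

not-fixed : ∀ {b} → not b ≢ b
not-fixed eq = not-¬ refl (sym eq)

-- `o` exchanges the two arcs with a common end and `p` the two with a common start. On the arcs
-- both are involutions without fixed points, and the alternating cycles are their joint orbits.
module TwoRegular (G : Digraph) (dd : Is2dd G) where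

  private
    degrees : ∀ {v} → v ∈ V G → (indeg G v , outdeg G v) ≡ (2 , 2)
    degrees v∈ = proj₂ (∈verticesOfDegree⁻ G _ (proj₂ dd v∈))

  indeg≡2 : ∀ {v} → v ∈ V G → indeg G v ≡ 2
  indeg≡2 v∈ = cong proj₁ (degrees v∈)

  outdeg≡2 : ∀ {v} → v ∈ V G → outdeg G v ≡ 2
  outdeg≡2 v∈ = cong proj₂ (degrees v∈)

  coEnd : Mates G (tgt G)
  coEnd = mates G (tgt G) (λ e∈ → indeg≡2 (tgt∈ G e∈))

  coStart : Mates G (src G)
  coStart = mates G (src G) (λ e∈ → outdeg≡2 (src∈ G e∈))

  open Mates coEnd public using ()
    renaming (mate to o; mate∈ to o∈; mate≢ to o≢; end-mate to tgt-o; only to tgt-only;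
              mate-involutive to o-involutive; mate-injective to o-injective)
  open Mates coStart public using ()
    renaming (mate to p; mate∈ to p∈; mate≢ to p≢; end-mate to src-p; only to src-only;
              mate-involutive to p-involutive; mate-injective to p-injective)

  inArc : ∀ {v} → v ∈ V G → ∃[ e ] e ∈ A G × tgt G e ≡ v
  inArc {v} v∈ = let e , _ , _ , e∈ , _ = ∣p∣≡2⇒pair ⟦ arcsWithEnd? G (tgt G) v ⟧ (indeg≡2 v∈) in
    e , ∈⟦⟧⁻ (arcsWithEnd? G (tgt G) v) e∈

  outArc : ∀ {v} → v ∈ V G → ∃[ e ] e ∈ A G × src G e ≡ v
  outArc {v} v∈ = let e , _ , _ , e∈ , _ = ∣p∣≡2⇒pair ⟦ arcsWithEnd? G (src G) v ⟧ (outdeg≡2 v∈) in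
    e , ∈⟦⟧⁻ (arcsWithEnd? G (src G) v) e∈

  step : Bool → Fin (m G) → Fin (m G)
  step true  = o
  step false = p

  step∈ : ∀ b {e} → e ∈ A G → step b e ∈ A G
  step∈ true  = o∈
  step∈ false = p∈

  step≢ : ∀ b {e} → e ∈ A G → step b e ≢ e
  step≢ true  = o≢
  step≢ false = p≢

  step-involutive : ∀ b {e} → e ∈ A G → step b (step b e) ≡ e
  step-involutive true  = o-involutive
  step-involutive false = p-involutive

  walk : Fin (m G) → ℕ → Fin (m G)
  walk e zero    = e
  walk e (suc k) = step (even k) (walk e k)

  walk∈ : ∀ {e} → e ∈ A G → ∀ k → walk e k ∈ A G
  walk∈ e∈ zero    = e∈
  walk∈ e∈ (suc k) = step∈ (even k) (walk∈ e∈ k)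

  -- Two walks meeting at different parities would have to fold back on each other, which
  -- the absence of fixed points of o and p forbids.
  private
    module _ {e} (e∈ : e ∈ A G) {j} (distinct : ∀ {a b} → a < suc j → b < suc j → walk e a ≡ walk e b → a ≡ b) where

      w : ℕ → Fin (m G)
      w = walk e

      same-parity : ∀ i → i < suc j → w i ≡ w (suc j) → even i ≡ even (suc j)
      same-parity i i<j eq with even i Bool.≟ not (even j)
      ... | yes same = same
      ... | no  differ with ℕ.m≤n⇒m<n∨m≡n i<j
      ... | inj₂ refl = contradiction (sym eq) (step≢ (even i) (walk∈ e∈ i))
      ... | inj₁ 1+i<1+j = contradiction (trans (cong even 1+i≡j) (sym parity)) not-fixed
        where
        parity : even i ≡ even j
        parity = not-injective (not-≢ differ)
        1+i≡j : suc i ≡ j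
        1+i≡j = distinct 1+i<1+j (ℕ.n<1+n j)
          (trans (cong₂ step parity eq) (step-involutive (even j) (walk∈ e∈ j)))

      starts-at-zero : ∀ i → i < suc j → w i ≡ w (suc j) → i ≡ 0
      starts-at-zero zero    i<j eq = refl
      starts-at-zero (suc i) i<j eq = contradiction
        (distinct (ℕ.<-trans (ℕ.n<1+n i) i<j) (ℕ.n<1+n j)
          (trans (sym (step-involutive (even i) (walk∈ e∈ i)))
            (trans (cong₂ step parity eq) (step-involutive (even j) (walk∈ e∈ j)))))
        (λ { refl → ℕ.<-irrefl refl i<j })
        where
        parity : even i ≡ even j
        parity = not-injective (same-parity (suc i) i<j eq)

  -- Keeping the size of the cycle as the exact period of the walk lets an assumption on sizes of
  -- alternating cycles be read as a statement about `walk`.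
  TracedBy : Fin (m G) → AC G → Set
  TracedBy e C = walk e (AC.size C) ≡ e ×
    (∀ {a b} → a < AC.size C → b < AC.size C → walk e a ≡ walk e b → a ≡ b)

  -- The first repetition is a return to `e` by `starts-at-zero`, and at an even index by
  -- `same-parity`, so up to there the walk is an alternating cycle.
  walkAC : ∀ {e} → e ∈ A G → ∃ (TracedBy e)
  walkAC {e} e∈ = build (firstRepetition (walk e))
    where
    close : ∀ r .{{_ : NonZero r}} → walk e 0 ≡ walk e (2 * r) →
            (∀ {a b} → a < 2 * r → b < 2 * r → walk e a ≡ walk e b → a ≡ b) → ∃ (TracedBy e)
    close r eq distinct = record
      { r           = r
      ; arc         = walk e ∘ toℕ
      ; arc∈        = λ i → walk∈ e∈ (toℕ i)
      ; distinct    = λ {a} {b} eq → Fin.toℕ-injective (distinct (Fin.toℕ<n a) (Fin.toℕ<n b) eq)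
      ; commonEnd   = λ i ev → sym (trans (cong (tgt G) (continue i true (%2≡0⇒even (toℕ i) ev))) (tgt-o (walk∈ e∈ (toℕ i))))
      ; commonStart = λ i od → sym (trans (cong (src G) (continue i false (%2≡1⇒odd (toℕ i) od))) (src-p (walk∈ e∈ (toℕ i))))
      } , sym eq , distinct
      where
      continue : ∀ (i : Fin (2 * r)) b → even (toℕ i) ≡ b → walk e (toℕ (next i)) ≡ step b (walk e (toℕ i))
      continue i b refl with toℕ-next i
      ... | inj₁ (_ , eq′)   = cong (walk e) eq′
      ... | inj₂ (eq″ , eq′) = trans (cong (walk e) eq′) (trans eq (cong (walk e) (sym eq″)))
    build : FirstRepetition (walk e) → ∃ (TracedBy e)
    build record { i = i ; j = suc j ; i<j = i<j ; repeated = eq ; distinct = distinct } =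
      go (starts-at-zero e∈ distinct i i<j eq)
      where
      go : i ≡ 0 → ∃ (TracedBy e)
      go refl with even⇒double (suc j) (sym (same-parity e∈ distinct 0 i<j eq))
      ... | suc r , eq′ = close (suc r) (trans eq (cong (walk e) eq′))
          (subst (λ k → ∀ {a b} → a < k → b < k → walk e a ≡ walk e b → a ≡ b) eq′ distinct)

  -- For a set of arcs, invariance under both involutions means being a union of alternating cycles.
  Closed : (Fin (m G) → Set) → Set
  Closed P = ∀ {e} → e ∈ A G → P e → P (o e) × P (p e)

  -- The factor condition as seen from one arc: exactly one of `e` and `o e`, and exactly one of `e`
  -- and `p e`, belongs to `T`.
  record AlternatingAt (T : Subset (m G)) (e : Fin (m G)) : Set where
    field
      o-leaves : e ∈ T → o e ∉ T
      o-enters : e ∉ T → o e ∈ T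
      p-leaves : e ∈ T → p e ∉ T
      p-enters : e ∉ T → p e ∈ T

  Alternating : Subset (m G) → Set
  Alternating T = ∀ {e} → e ∈ A G → AlternatingAt T e

  module _ {T} (T⊆A : T ⊆ A G) (alt : Alternating T) where

    private
      module _ {e} (e∈ : e ∈ A G) where
        open AlternatingAt (alt e∈) public

    alternating⇒cycleCover : CycleCover (spanning G T T⊆A)
    alternating⇒cycleCover = record
      { after         = after
      ; src-injective = src-inj
      ; tgt-injective = tgt-inj
      }
      where
      after : ∀ {e} → e ∈ T → ∃[ e′ ] e′ ∈ T × tgt G e ≡ src G e′
      after e∈ with outArc (tgt∈ G (T⊆A e∈))
      ... | x , x∈ , eq with x ∈? T
      ... | yes x∈T = x , x∈T , sym eq
      ... | no  x∉T = p x , p-enters x∈ x∉T , sym (trans (src-p x∈) eq)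
      src-inj : ∀ {e e′} → e ∈ T → e′ ∈ T → src G e ≡ src G e′ → e ≡ e′
      src-inj e∈ e′∈ eq with src-only (T⊆A e∈) (T⊆A e′∈) (sym eq)
      ... | inj₁ same = sym same
      ... | inj₂ refl = contradiction e′∈ (p-leaves (T⊆A e∈) e∈)
      tgt-inj : ∀ {e e′} → e ∈ T → e′ ∈ T → tgt G e ≡ tgt G e′ → e ≡ e′
      tgt-inj e∈ e′∈ eq with tgt-only (T⊆A e∈) (T⊆A e′∈) (sym eq)
      ... | inj₁ same = sym same
      ... | inj₂ refl = contradiction e′∈ (o-leaves (T⊆A e∈) e∈)

  -- Coordinates of the hexagon of a: its arcs of side true are every second one from a on,
  -- and the two arcs with index i are those with the same start.
  hex : Fin (m G) → Bool → Fin 3 → Fin (m G)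
  hex a true  0F = a
  hex a false 1F = o a
  hex a true  1F = p (o a)
  hex a false 2F = o (p (o a))
  hex a true  2F = p (o (p (o a)))
  hex a false 0F = o (p (o (p (o a))))

  position : Bool → Fin 3 → ℕ
  position true  0F = 0
  position false 1F = 1
  position true  1F = 2
  position false 2F = 3
  position true  2F = 4
  position false 0F = 5

  position<6 : ∀ b i → position b i < 6
  position<6 true  0F = s≤s z≤n
  position<6 false 1F = s≤s (s≤s z≤n)
  position<6 true  1F = s≤s (s≤s (s≤s z≤n))
  position<6 false 2F = s≤s (s≤s (s≤s (s≤s z≤n)))
  position<6 true  2F = s≤s (s≤s (s≤s (s≤s (s≤s z≤n))))
  position<6 false 0F = s≤s (s≤s (s≤s (s≤s (s≤s (s≤s z≤n)))))

  coordinates : ℕ → Bool × Fin 3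
  coordinates 0 = true  , 0F
  coordinates 1 = false , 1F
  coordinates 2 = true  , 1F
  coordinates 3 = false , 2F
  coordinates 4 = true  , 2F
  coordinates _ = false , 0F

  coordinates-position : ∀ b i → coordinates (position b i) ≡ (b , i)
  coordinates-position true  0F = refl
  coordinates-position false 1F = refl
  coordinates-position true  1F = refl
  coordinates-position false 2F = refl
  coordinates-position true  2F = refl
  coordinates-position false 0F = refl

  hex≡walk : ∀ a b i → hex a b i ≡ walk a (position b i)
  hex≡walk a true  0F = refl
  hex≡walk a false 1F = refl
  hex≡walk a true  1F = refl
  hex≡walk a false 2F = refl
  hex≡walk a true  2F = refl
  hex≡walk a false 0F = refl

  hex∈ : ∀ {a} → a ∈ A G → ∀ b i → hex a b i ∈ A G
  hex∈ {a} a∈ b i = subst (_∈ A G) (sym (hex≡walk a b i)) (walk∈ a∈ (position b i))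

  private
    undo : ∀ {P} → Closed P → ∀ b {e} → e ∈ A G → P (step b e) → P e
    undo {P} closed true  e∈ Pe = subst P (o-involutive e∈) (proj₁ (closed (o∈ e∈) Pe))
    undo {P} closed false e∈ Pe = subst P (p-involutive e∈) (proj₂ (closed (p∈ e∈) Pe))

  module _ {P : Fin (m G) → Set} (closed : Closed P) {a} (a∈ : a ∈ A G) where

    closed-walk : P a → ∀ k → P (walk a k)
    closed-walk Pa zero    = Pa
    closed-walk Pa (suc k) with even k
    ... | true  = proj₁ (closed (walk∈ a∈ k) (closed-walk Pa k))
    ... | false = proj₂ (closed (walk∈ a∈ k) (closed-walk Pa k))

    closed-unwalk : ∀ k → P (walk a k) → P a
    closed-unwalk zero    Pa = Pa
    closed-unwalk (suc k) Pa = closed-unwalk k (undo {P} closed (even k) (walk∈ a∈ k) Pa)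

    closed-hex : P a → ∀ b i → P (hex a b i)
    closed-hex Pa b i = subst P (sym (hex≡walk a b i)) (closed-walk Pa (position b i))

    closed-unhex : ∀ b i → P (hex a b i) → P a
    closed-unhex b i Pe = closed-unwalk (position b i) (subst P (hex≡walk a b i) Pe)

  -- Coordinates on alternating cycles with six arcs.

  module Hexagonal (six : AllACsOfSize G 6) where

    walk-6 : ∀ {e} → e ∈ A G → walk e 6 ≡ e
    walk-6 e∈ with walkAC e∈
    ... | C , closes , _ = trans (cong (walk _) (sym (six C))) closes

    walk-distinct : ∀ {e} → e ∈ A G → ∀ {a b} → a < 6 → b < 6 → walk e a ≡ walk e b → a ≡ b
    walk-distinct {e} e∈ {a} {b} a<6 b<6 with walkAC e∈
    ... | C , _ , distinct = distinct (subst (a <_) (sym (six C)) a<6) (subst (b <_) (sym (six C)) b<6)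

    hex-injective : ∀ {a} → a ∈ A G → ∀ {b i c j} → hex a b i ≡ hex a c j → (b , i) ≡ (c , j)
    hex-injective {a} a∈ {b} {i} {c} {j} eq = trans (sym (coordinates-position b i)) (trans
      (cong coordinates (walk-distinct a∈ (position<6 b i) (position<6 c j)
        (trans (sym (hex≡walk a b i)) (trans eq (hex≡walk a c j)))))
      (coordinates-position c j))

    p-hex : ∀ {a} → a ∈ A G → ∀ b i → p (hex a b i) ≡ hex a (not b) i
    p-hex a∈ true  0F = trans (cong p (sym (walk-6 a∈))) (p-involutive (walk∈ a∈ 5))
    p-hex a∈ false 0F = walk-6 a∈
    p-hex a∈ true  1F = p-involutive (walk∈ a∈ 1)
    p-hex a∈ false 1F = refl
    p-hex a∈ true  2F = p-involutive (walk∈ a∈ 3)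
    p-hex a∈ false 2F = refl

    o-hex-true : ∀ {a} → a ∈ A G → ∀ i → o (hex a true i) ≡ hex a false (succ₃ i)
    o-hex-true a∈ 0F = refl
    o-hex-true a∈ 1F = refl
    o-hex-true a∈ 2F = refl

    o-hex-false : ∀ {a} → a ∈ A G → ∀ i → o (hex a false i) ≡ hex a true (pred₃ i)
    o-hex-false a∈ 0F = o-involutive (walk∈ a∈ 4)
    o-hex-false a∈ 1F = o-involutive (walk∈ a∈ 0)
    o-hex-false a∈ 2F = o-involutive (walk∈ a∈ 2)

    InHexagon : Fin (m G) → Fin (m G) → Set
    InHexagon a e = ∃[ b ] ∃[ i ] hex a b i ≡ e

    inHexagon-closed : ∀ {a} → a ∈ A G → Closed (InHexagon a)
    inHexagon-closed a∈ _ (true  , i , refl) = (false , succ₃ i , sym (o-hex-true a∈ i)) , (false , i , sym (p-hex a∈ true i))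
    inHexagon-closed a∈ _ (false , i , refl) = (true , pred₃ i , sym (o-hex-false a∈ i)) , (true , i , sym (p-hex a∈ false i))

    -- The hexagon of `e` is invariant and contains `e`; invariance also carries membership
    -- backwards along the walk from `a` to `e`.
    inHexagon-sym : ∀ {a e} → a ∈ A G → InHexagon a e → InHexagon e a
    inHexagon-sym a∈ (b , i , refl) = closed-unhex (inHexagon-closed (hex∈ a∈ b i)) a∈ b i (true , 0F , refl)

    inHexagon-trans : ∀ {a b e} → a ∈ A G → InHexagon a b → InHexagon b e → InHexagon a e
    inHexagon-trans a∈ (x , i , refl) (y , j , refl) = closed-hex (inHexagon-closed a∈) (hex∈ a∈ x i) (x , i , refl) y j

    -- Identifies an arbitrary alternating cycle with the hexagon of one of its arcs. The parity of
    -- the index becomes the side, so forward arcs are those of side `true`.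
    record Chart (C : AC G) : Set where
      field
        base        : Fin (m G)
        base∈       : base ∈ A G
        arc-hex     : ∀ i → ∃[ b ] b ≡ even (toℕ i) × ∃[ k ] hex base b k ≡ AC.arc C i
        hex-arc     : ∀ b k → ∃[ i ] AC.arc C i ≡ hex base b k

    abstract
      chart : ∀ C → Chart C
      chart C@(record { r = r ; arc = arc ; arc∈ = arc∈ ; distinct = distinct ; commonEnd = commonEnd ; commonStart = commonStart })
        with ℕ.*-cancelˡ-≡ r 3 2 (six C)
      ... | refl = record { base = arc 0F ; base∈ = arc∈ 0F ; arc-hex = arc-hex ; hex-arc = hex-arc }
        where
        -- Neighbouring arcs with a common end are distinct, hence mates; among six indices none is
        -- its own successor.
        across : ∀ i → toℕ i % 2 ≡ 0 → next i ≢ i → arc (next i) ≡ o (arc i)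
        across i ev moves with tgt-only (arc∈ i) (arc∈ (next i)) (sym (commonEnd i ev))
        ... | inj₁ eq = contradiction (distinct eq) moves
        ... | inj₂ eq = eq
        along : ∀ i → toℕ i % 2 ≡ 1 → next i ≢ i → arc (next i) ≡ p (arc i)
        along i od moves with src-only (arc∈ i) (arc∈ (next i)) (sym (commonStart i od))
        ... | inj₁ eq = contradiction (distinct eq) moves
        ... | inj₂ eq = eq
        arc1 : arc 1F ≡ hex (arc 0F) false 1F
        arc1 = across 0F refl λ ()
        arc2 : arc 2F ≡ hex (arc 0F) true 1F
        arc2 = trans (along 1F refl λ ()) (cong p arc1)
        arc3 : arc 3F ≡ hex (arc 0F) false 2F
        arc3 = trans (across 2F refl λ ()) (cong o arc2)
        arc4 : arc 4F ≡ hex (arc 0F) true 2F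
        arc4 = trans (along 3F refl λ ()) (cong p arc3)
        arc5 : arc 5F ≡ hex (arc 0F) false 0F
        arc5 = trans (across 4F refl λ ()) (cong o arc4)
        arc-hex : ∀ i → ∃[ b ] b ≡ even (toℕ i) × ∃[ k ] hex (arc 0F) b k ≡ arc i
        arc-hex 0F = true  , refl , 0F , refl
        arc-hex 1F = false , refl , 1F , sym arc1
        arc-hex 2F = true  , refl , 1F , sym arc2
        arc-hex 3F = false , refl , 2F , sym arc3
        arc-hex 4F = true  , refl , 2F , sym arc4
        arc-hex 5F = false , refl , 0F , sym arc5
        hex-arc : ∀ b k → ∃[ i ] arc i ≡ hex (arc 0F) b k
        hex-arc true  0F = 0F , refl
        hex-arc false 1F = 1F , arc1
        hex-arc true  1F = 2F , arc2
        hex-arc false 2F = 3F , arc3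
        hex-arc true  2F = 4F , arc4
        hex-arc false 0F = 5F , arc5

    hexAC : ∀ {a} → a ∈ A G → AC G
    hexAC {a} a∈ = record
      { r           = 3
      ; arc         = λ i → walk a (toℕ i)
      ; arc∈        = λ i → walk∈ a∈ (toℕ i)
      ; distinct    = λ {i} {j} eq → Fin.toℕ-injective (walk-distinct a∈ (Fin.toℕ<n i) (Fin.toℕ<n j) eq)
      ; commonEnd   = commonEnd
      ; commonStart = commonStart
      }
      where
      commonEnd : ∀ (i : Fin 6) → toℕ i % 2 ≡ 0 → tgt G (walk a (toℕ i)) ≡ tgt G (walk a (toℕ (next i)))
      commonEnd 0F _ = sym (tgt-o (walk∈ a∈ 0))
      commonEnd 1F ()
      commonEnd 2F _ = sym (tgt-o (walk∈ a∈ 2))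
      commonEnd 3F ()
      commonEnd 4F _ = sym (tgt-o (walk∈ a∈ 4))
      commonEnd 5F ()
      commonStart : ∀ (i : Fin 6) → toℕ i % 2 ≡ 1 → src G (walk a (toℕ i)) ≡ src G (walk a (toℕ (next i)))
      commonStart 0F ()
      commonStart 1F _ = sym (src-p (walk∈ a∈ 1))
      commonStart 2F ()
      commonStart 3F _ = sym (src-p (walk∈ a∈ 3))
      commonStart 4F ()
      commonStart 5F _ = sym (trans (cong (src G) (sym (walk-6 a∈))) (src-p (walk∈ a∈ 5)))

    arc-hexAC : ∀ {a e} (a∈ : a ∈ A G) → InHexagon a e → ∃[ i ] AC.arc (hexAC a∈) i ≡ e
    arc-hexAC {a} a∈ (true  , 0F , refl) = 0F , refl
    arc-hexAC {a} a∈ (false , 1F , refl) = 1F , refl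
    arc-hexAC {a} a∈ (true  , 1F , refl) = 2F , refl
    arc-hexAC {a} a∈ (false , 2F , refl) = 3F , refl
    arc-hexAC {a} a∈ (true  , 2F , refl) = 4F , refl
    arc-hexAC {a} a∈ (false , 0F , refl) = 5F , refl

    closed⇒all-or-none : ∀ {T} → Closed (_∈ T) → (C : AC G) →
      (∀ i → AC.arc C i ∈ T) ⊎ (∀ i → AC.arc C i ∉ T)
    closed⇒all-or-none {T} closed C = decide (base ∈? T)
      where
      open Chart (chart C)
      decide : Dec (base ∈ T) → (∀ i → AC.arc C i ∈ T) ⊎ (∀ i → AC.arc C i ∉ T)
      decide (yes b∈) = inj₁ λ i → let b , _ , k , eq = arc-hex i in subst (_∈ T) eq (closed-hex closed base∈ b∈ b k)
      decide (no  b∉) = inj₂ λ i i∈ → let b , _ , k , eq = arc-hex i in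
        b∉ (closed-unhex closed base∈ b k (subst (_∈ T) (sym eq) i∈))

    all-or-none⇒closed : ∀ {T} → (∀ {a} (a∈ : a ∈ A G) → (∀ i → AC.arc (hexAC a∈) i ∈ T) ⊎ (∀ i → AC.arc (hexAC a∈) i ∉ T)) →
      Closed (_∈ T)
    all-or-none⇒closed {T} union {a} a∈ a∈T with union a∈
    -- Indices 1 and 5 of the cycle carry the two neighbours `o a` and `p a` of index 0.
    ... | inj₁ all  = all 1F , subst (_∈ T) (sym (p-hex a∈ true 0F)) (all 5F)
    ... | inj₂ none = contradiction a∈T (none 0F)

    OneSide : Subset (m G) → AC G → Set
    OneSide T C = (AC.Forward C ⊆ᴾ (_∈ T) × AC.Backward C ⊆ᴾ (_∉ T))
                ⊎ (AC.Backward C ⊆ᴾ (_∈ T) × AC.Forward C ⊆ᴾ (_∉ T))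

    -- Going round the hexagon, each application of `o` or `p` flips membership in `T`, so the
    -- membership of the base arc fixes all six.
    alternating⇒oneSide : ∀ {T} (C : AC G) → (∀ i → AlternatingAt T (AC.arc C i)) → OneSide T C
    alternating⇒oneSide {T} C alt = decide (base ∈? T)
      where
      open Chart (chart C)
      at : ∀ b k → AlternatingAt T (hex base b k)
      at b k = let i , eq = hex-arc b k in subst (AlternatingAt T) eq (alt i)
      module At b k = AlternatingAt (at b k)
      split-sides : ∀ {P Q : Fin (m G) → Set} → (∀ k → P (hex base true k)) → (∀ k → Q (hex base false k)) →
                    AC.Forward C ⊆ᴾ P × AC.Backward C ⊆ᴾ Q
      split-sides {P} {Q} onTrue onFalse = forward , backward
        where
        forward : AC.Forward C ⊆ᴾ P
        forward (i , ev , refl) with arc-hex i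
        ... | b , b≡ , k , eq with trans b≡ (%2≡0⇒even (toℕ i) ev)
        ... | refl = subst P eq (onTrue k)
        backward : AC.Backward C ⊆ᴾ Q
        backward (i , od , refl) with arc-hex i
        ... | b , b≡ , k , eq with trans b≡ (%2≡1⇒odd (toℕ i) od)
        ... | refl = subst Q eq (onFalse k)
      decide : Dec (base ∈ T) → OneSide T C
      decide (yes t0) = inj₁ (split-sides (λ { 0F → t0 ; 1F → t1 ; 2F → t2 }) (λ { 0F → f0 ; 1F → f1 ; 2F → f2 }))
        where
        f1 = At.o-leaves true 0F t0
        t1 = At.p-enters false 1F f1
        f2 = At.o-leaves true 1F t1
        t2 = At.p-enters false 2F f2
        f0 = At.o-leaves true 2F t2
      decide (no t0) = let onTrue , onFalse = split-sides (λ { 0F → t0 ; 1F → t1 ; 2F → t2 }) (λ { 0F → f0 ; 1F → f1 ; 2F → f2 }) in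
        inj₂ (onFalse , onTrue)
        where
        f1 = At.o-enters true 0F t0
        t1 = At.p-leaves false 1F f1
        f2 = At.o-enters true 1F t1
        t2 = At.p-leaves false 2F f2
        f0 = At.o-enters true 2F t2

    oneSide⇒alternatingAt : ∀ {T e} (e∈ : e ∈ A G) → OneSide T (hexAC e∈) → AlternatingAt T e
    oneSide⇒alternatingAt {T} {e} e∈ (inj₁ (onTrue , onFalse)) = record
      { o-leaves = λ _ → onFalse (1F , refl , refl)
      ; o-enters = λ e∉ → contradiction (onTrue (0F , refl , refl)) e∉
      ; p-leaves = λ _ → subst (_∉ T) (sym (p-hex e∈ true 0F)) (onFalse (5F , refl , refl))
      ; p-enters = λ e∉ → contradiction (onTrue (0F , refl , refl)) e∉
      }
    oneSide⇒alternatingAt {T} {e} e∈ (inj₂ (onFalse , onTrue)) = record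
      { o-leaves = λ e∈T → contradiction e∈T (onTrue (0F , refl , refl))
      ; o-enters = λ _ → onFalse (1F , refl , refl)
      ; p-leaves = λ e∈T → contradiction e∈T (onTrue (0F , refl , refl))
      ; p-enters = λ _ → subst (_∈ T) (sym (p-hex e∈ true 0F)) (onFalse (5F , refl , refl))
      }

-- Circulating sets of arcs, and subgraphs as invariant sets.

∣⟦none⟧∣≡0 : ∀ {n P} (P? : Decidable {A = Fin n} P) → (∀ i → ¬ P i) → ∣ ⟦ P? ⟧ ∣ ≡ 0
∣⟦none⟧∣≡0 {zero}  P? none = refl
∣⟦none⟧∣≡0 {suc n} P? none rewrite dec-false (P? zero) (none zero) = ∣⟦none⟧∣≡0 (P? ∘ suc) (none ∘ suc)

-- Witnesses a cycle inside `f`, since a nonempty finite set in which every arc has a successor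
-- contains one. Searching all subsets makes `Acyclic` decidable, and the predecessors supply the
-- field `back` of a `Circulation`.
Circulating : (G : Digraph) → Subset (m G) → Subset (m G) → Set
Circulating G f P = Nonempty P × P ⊆ f ×
  (∀ e → e ∈ P → ∃[ e′ ] e′ ∈ P × tgt G e ≡ src G e′) ×
  (∀ e → e ∈ P → ∃[ e′ ] e′ ∈ P × tgt G e′ ≡ src G e)

Acyclic : (G : Digraph) → Subset (m G) → Set
Acyclic G f = ¬ ∃ (Circulating G f)

circulating? : ∀ G f → Dec (∃ (Circulating G f))
circulating? G f = anySubset? λ P → nonempty? P ×-dec (P ⊆? f) ×-dec
  (Fin.all? λ e → (e ∈? P) →-dec Fin.any? λ e′ → (e′ ∈? P) ×-dec (_ Fin.≟ _)) ×-dec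
  (Fin.all? λ e → (e ∈? P) →-dec Fin.any? λ e′ → (e′ ∈? P) ×-dec (_ Fin.≟ _))

acyclic? : ∀ G f → Dec (Acyclic G f)
acyclic? G f = ¬? (circulating? G f)

module ClosedSubsets (G : Digraph) (dd : Is2dd G) (six : AllACsOfSize G 6) where

  open TwoRegular G dd public
  open Hexagonal six public

  -- An alternating cycle is the whole hexagon of any of its arcs, so equality of alternating cycles
  -- becomes a matter of one common arc.
  terms : ∀ (C : AC G) {e e′} → (∃[ i ] AC.arc C i ≡ e) → (∃[ j ] AC.arc C j ≡ e′) ⇔ InHexagon e e′
  terms C {e} {e′} e-on = mk⇔
    (λ e′-on → inHexagon-trans e∈ (inHexagon-sym base∈ (in-base e-on)) (in-base e′-on))
    (λ in-e → on-C (inHexagon-trans base∈ (in-base e-on) in-e))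
    where
    open Chart (chart C)
    in-base : ∀ {e} → (∃[ i ] AC.arc C i ≡ e) → InHexagon base e
    in-base (i , eq) = let b , _ , k , eq′ = arc-hex i in b , k , trans eq′ eq
    on-C : ∀ {e} → InHexagon base e → ∃[ i ] AC.arc C i ≡ e
    on-C (b , k , eq) = let i , eq′ = hex-arc b k in i , trans eq′ eq
    e∈ : e ∈ A G
    e∈ = subst (_∈ A G) (proj₂ e-on) (AC.arc∈ C (proj₁ e-on))

  inHexagon? : ∀ a e → Dec (InHexagon a e)
  inHexagon? a e = map′ [ (true ,_) , (false ,_) ]′ (λ { (true , i) → inj₁ i ; (false , i) → inj₂ i })
    ((Fin.any? λ i → hex a true i Fin.≟ e) ⊎-dec (Fin.any? λ i → hex a false i Fin.≟ e))

  inHexagon-refl : ∀ {a} → InHexagon a a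
  inHexagon-refl = true , 0F , refl

  src-hex : ∀ {a} → a ∈ A G → ∀ b i → src G (hex a b i) ≡ src G (hex a true i)
  src-hex a∈ true  i = refl
  src-hex a∈ false i = trans (sym (src-p (hex∈ a∈ false i))) (cong (src G) (p-hex a∈ false i))

  tgt-hex : ∀ {a} → a ∈ A G → ∀ b i → tgt G (hex a b i) ≡ tgt G (hex a true (π b i))
  tgt-hex a∈ true  i = refl
  tgt-hex a∈ false i = trans (sym (tgt-o (hex∈ a∈ false i))) (cong (tgt G) (o-hex-false a∈ i))

  module _ {S : Subset (m G)} (S⊆A : S ⊆ A G) (closed : Closed (_∈ S)) where

    in-all : ∀ {e e′} → e ∈ S → e′ ∈ A G → tgt G e′ ≡ tgt G e → e′ ∈ S
    in-all e∈ e′∈ eq with tgt-only (S⊆A e∈) e′∈ eq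
    ... | inj₁ refl = e∈
    ... | inj₂ refl = proj₁ (closed (S⊆A e∈) e∈)

    out-all : ∀ {e e′} → e ∈ S → e′ ∈ A G → src G e′ ≡ src G e → e′ ∈ S
    out-all e∈ e′∈ eq with src-only (S⊆A e∈) e′∈ eq
    ... | inj₁ refl = e∈
    ... | inj₂ refl = proj₂ (closed (S⊆A e∈) e∈)

  -- The digraphs with the arcs S of G, whatever their vertex set, such as induced subgraphs
  -- of induced subgraphs.
  module _ {W : Subset (n G)} {S : Subset (m G)}
           {src∈S : ∀ {e} → e ∈ S → src G e ∈ W} {tgt∈S : ∀ {e} → e ∈ S → tgt G e ∈ W} (S⊆A : S ⊆ A G) where

    private
      K : Digraph
      K = record { n = n G ; m = m G ; V = W ; A = S ; src = src G ; tgt = tgt G ; src∈ = src∈S ; tgt∈ = tgt∈S }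

    embed : AC K → AC G
    embed C = AC-map id id (λ _ _ → id) (λ _ _ → id) C (S⊆A ∘ AC.arc∈ C)

    module _ (closed : Closed (_∈ S)) where

      restrict : ∀ {a} → a ∈ S → AC K
      restrict a∈ = AC-map id id (λ _ _ → id) (λ _ _ → id) (hexAC (S⊆A a∈))
        (closed-walk closed (S⊆A a∈) a∈ ∘ toℕ)

      indeg-induced : ∀ {e v} → e ∈ S → tgt G e ≡ v → indeg K v ≡ 2
      indeg-induced {e} {v} e∈ refl = trans
        (cong ∣_∣ (⟦⟧-cong (arcsWithEnd? K (tgt G) v) (arcsWithEnd? G (tgt G) v) λ e′ →
          mk⇔ (λ (e′∈ , eq) → S⊆A e′∈ , eq) (λ (e′∈ , eq) → in-all S⊆A closed e∈ e′∈ eq , eq)))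
        (indeg≡2 (tgt∈ G (S⊆A e∈)))

      outdeg-induced : ∀ {e v} → e ∈ S → src G e ≡ v → outdeg K v ≡ 2
      outdeg-induced {e} {v} e∈ refl = trans
        (cong ∣_∣ (⟦⟧-cong (arcsWithEnd? K (src G) v) (arcsWithEnd? G (src G) v) λ e′ →
          mk⇔ (λ (e′∈ , eq) → S⊆A e′∈ , eq) (λ (e′∈ , eq) → out-all S⊆A closed e∈ e′∈ eq , eq)))
        (outdeg≡2 (src∈ G (S⊆A e∈)))

      saturated-induced : ∀ {e e′ v} → e ∈ S → tgt G e ≡ v → e′ ∈ S → src G e′ ≡ v → v ∈ saturated K
      saturated-induced {e} {e′} e∈ eq e′∈ eq′ = ∈verticesOfDegree⁺ K (2 , 2)
        (subst (_∈ V K) eq (tgt∈ K e∈))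
        (cong₂ _,_ (indeg-induced e∈ eq) (outdeg-induced e′∈ eq′))

-- The hexagons of F and an acyclic choice of their sides.

module ThreeHexagonSubgraph (G : Digraph) (dd : Is2dd G) (clean : Clean G) (six : AllACsOfSize G 6)
  (F : Subgraph G) (three : HasACs ⟨ F ⟩ 3)
  (few-shared : ¬ (∃[ H ] HasACs (⟨_⟩ {⟨ F ⟩} H) 2 × 2 < ∣ saturated (⟨_⟩ {⟨ F ⟩} H) ∣)) where

  open ClosedSubsets G dd six
  open Subgraph F using (arcs; arcs⊆; unionOfACs)

  arcs-closed : Closed (_∈ arcs)
  arcs-closed = all-or-none⇒closed λ a∈ → unionOfACs (hexAC a∈)

  private
    module _ (x : Fin 3) where
      open Chart (chart (embed arcs⊆ (proj₁ three x))) public using (base; base∈)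
      base-on : ∃[ i ] AC.arc (proj₁ three x) i ≡ base
      base-on = Chart.hex-arc (chart (embed arcs⊆ (proj₁ three x))) true 0F

  base∈F : ∀ x → base x ∈ arcs
  base∈F x = let i , eq = base-on x in subst (_∈ arcs) eq (AC.arc∈ (proj₁ three x) i)

  hexagons-cover : ∀ {e} → e ∈ arcs → ∃[ x ] InHexagon (base x) e
  hexagons-cover {e} e∈ = let x , same = proj₂ (proj₂ three) (restrict arcs⊆ arcs-closed e∈) in
    x , Equivalence.to (terms (embed arcs⊆ (proj₁ three x)) (base-on x)) (Equivalence.from (same refl e) (0F , refl))

  hexagons-disjoint : ∀ {x y e} → InHexagon (base x) e → InHexagon (base y) e → x ≡ y
  hexagons-disjoint {x} {y} {e} in-x in-y = proj₁ (proj₂ three) λ a → mk⇔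
    (λ on → Equivalence.from (terms Y (base-on y)) (inHexagon-trans (base∈ y) y∋x (Equivalence.to (terms X (base-on x)) on)))
    (λ on → Equivalence.from (terms X (base-on x)) (inHexagon-trans (base∈ x) (inHexagon-sym (base∈ y) y∋x)
        (Equivalence.to (terms Y (base-on y)) on)))
    where
    X = embed arcs⊆ (proj₁ three x)
    Y = embed arcs⊆ (proj₁ three y)
    y∋x : InHexagon (base y) (base x)
    y∋x = inHexagon-trans (base∈ y) in-y (inHexagon-sym (base∈ x) in-x)

  s t : Fin 3 → Fin 3 → Fin (n G)
  s x i = src G (hex (base x) true i)
  t x i = tgt G (hex (base x) true i)

  private
    hex∈A : ∀ x b i → hex (base x) b i ∈ A G
    hex∈A x = hex∈ (base∈ x)

    hex-unique : ∀ {x b i y c j} → hex (base x) b i ≡ hex (base y) c j → x ≡ y × (b , i) ≡ (c , j)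
    hex-unique {x} {b} {i} {y} {c} {j} eq with hexagons-disjoint {x} {y} (b , i , refl) (c , j , sym eq)
    ... | refl = refl , hex-injective (base∈ x) eq

  -- Arcs with the same start are equal or exchanged by `p`, and `p` changes the side, while both
  -- arcs here have side `true`.
  s-injective : ∀ {x i y j} → s x i ≡ s y j → x ≡ y × i ≡ j
  s-injective {x} {i} {y} {j} eq with src-only (hex∈A x true i) (hex∈A y true j) (sym eq)
  ... | inj₁ eq′ with hex-unique {y} {true} {j} {x} {true} {i} eq′
  ... | refl , refl = refl , refl
  s-injective {x} {i} {y} {j} eq | inj₂ eq′
    with hex-unique {y} {true} {j} {x} {false} {i} (trans eq′ (p-hex (base∈ x) true i))
  ... | _ , ()

  t-injective : ∀ {x i y j} → t x i ≡ t y j → x ≡ y × i ≡ j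
  t-injective {x} {i} {y} {j} eq with tgt-only (hex∈A x true i) (hex∈A y true j) (sym eq)
  ... | inj₁ eq′ with hex-unique {y} {true} {j} {x} {true} {i} eq′
  ... | refl , refl = refl , refl
  t-injective {x} {i} {y} {j} eq | inj₂ eq′
    with hex-unique {y} {true} {j} {x} {false} {succ₃ i} (trans eq′ (o-hex-true (base∈ x) i))
  ... | _ , ()

  s≢t : ∀ x i j → s x i ≢ t x j
  s≢t x i j eq = let k , eq₁ = arc-hexAC (base∈ x) (true , i , refl)
                     l , eq₂ = arc-hexAC (base∈ x) (true , j , refl) in
    clean (hexAC (base∈ x)) (k , l , trans (cong (src G) eq₁) (trans eq (cong (tgt G) (sym eq₂))))

  open ThreeHexagons s t s-injective t-injective s≢t

  module Pair {x y : Fin 3} (x≢y : x ≢ y) where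

    InPair : Fin (m G) → Set
    InPair e = InHexagon (base x) e ⊎ InHexagon (base y) e

    inPair? : Decidable InPair
    inPair? e = inHexagon? (base x) e ⊎-dec inHexagon? (base y) e

    abstract
      pairArcs : Subset (m G)
      pairArcs = ⟦ inPair? ⟧

      ∈pair⁺ : ∀ {e} → InPair e → e ∈ pairArcs
      ∈pair⁺ = ∈⟦⟧⁺ inPair?

      ∈pair⁻ : ∀ {e} → e ∈ pairArcs → InPair e
      ∈pair⁻ = ∈⟦⟧⁻ inPair?

    pair⊆ : pairArcs ⊆ arcs
    pair⊆ e∈ = [ within x , within y ]′ (∈pair⁻ e∈)
      where
      within : ∀ z {e} → InHexagon (base z) e → e ∈ arcs
      within z (b , i , refl) = closed-hex arcs-closed (base∈ z) (base∈F z) b i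

    pair-closed : Closed (_∈ pairArcs)
    pair-closed e∈ e∈P = [ (λ inx → let in₁ , in₂ = inHexagon-closed (base∈ x) e∈ inx in ∈pair⁺ (inj₁ in₁) , ∈pair⁺ (inj₁ in₂))
                         , (λ iny → let in₁ , in₂ = inHexagon-closed (base∈ y) e∈ iny in ∈pair⁺ (inj₂ in₁) , ∈pair⁺ (inj₂ in₂))
                         ]′ (∈pair⁻ e∈P)

    x∈pair : ∀ i → hex (base x) true i ∈ pairArcs
    x∈pair i = ∈pair⁺ (inj₁ (true , i , refl))

    y∈pair : ∀ i → hex (base y) true i ∈ pairArcs
    y∈pair i = ∈pair⁺ (inj₂ (true , i , refl))

    pair : Subgraph ⟨ F ⟩
    pair = record
      { arcs       = pairArcs
      ; arcs⊆      = pair⊆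
      ; nonempty   = base x , x∈pair 0F
      ; unionOfACs = λ C → closed⇒all-or-none pair-closed (embed arcs⊆ C)
      }

    ⟨pair⟩ : Digraph
    ⟨pair⟩ = ⟨_⟩ {⟨ F ⟩} pair

    twoACs : HasACs ⟨pair⟩ 2
    twoACs = AC₂ , inj , surj
      where
      choose : Fin 2 → Fin 3
      choose 0F = x
      choose 1F = y
      choose-injective : Injective _≡_ _≡_ choose
      choose-injective {0F} {0F} eq = refl
      choose-injective {0F} {1F} eq = contradiction eq x≢y
      choose-injective {1F} {0F} eq = contradiction (sym eq) x≢y
      choose-injective {1F} {1F} eq = refl
      base∈pair : ∀ k → base (choose k) ∈ pairArcs
      base∈pair 0F = x∈pair 0F
      base∈pair 1F = y∈pair 0F
      pair⊆A : pairArcs ⊆ A G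
      pair⊆A = arcs⊆ ∘ pair⊆
      AC₂ : Fin 2 → AC ⟨pair⟩
      AC₂ k = restrict pair⊆A pair-closed (base∈pair k)
      terms₂ : ∀ k {e} → (∃[ i ] AC.arc (AC₂ k) i ≡ e) ⇔ InHexagon (base (choose k)) e
      terms₂ k = terms (embed pair⊆A (AC₂ k)) (0F , refl)
      inj : ∀ {k l} → SameTerms (AC.arc (AC₂ k)) (AC.arc (AC₂ l)) → k ≡ l
      inj {k} {l} same = choose-injective (hexagons-disjoint {choose k} {choose l} inHexagon-refl
        (Equivalence.to (terms₂ l) (Equivalence.to (same _) (0F , refl))))
      found : ∀ {e} → InPair e → ∃[ k ] InHexagon (base (choose k)) e
      found (inj₁ inx) = 0F , inx
      found (inj₂ iny) = 1F , iny
      surj : ∀ (C : AC ⟨pair⟩) → ∃[ k ] ∀ {l} → l ≡ k → SameTerms (AC.arc (AC₂ l)) (AC.arc C)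
      surj C = fromTerm (Chart.hex-arc (chart (embed pair⊆A C)) true 0F)
        where
        fromTerm : ∀ {c} → ∃[ i ] AC.arc C i ≡ c → _
        fromTerm {c} (i , eq) = sameAs (found (∈pair⁻ c∈pair))
          where
          c∈pair : c ∈ pairArcs
          c∈pair = subst (_∈ pairArcs) eq (AC.arc∈ C i)
          terms-C : ∀ {e} → (∃[ j ] AC.arc C j ≡ e) ⇔ InHexagon c e
          terms-C = terms (embed pair⊆A C) (i , eq)
          sameAs : ∃[ k ] InHexagon (base (choose k)) c → ∃[ k ] ∀ {l} → l ≡ k → SameTerms (AC.arc (AC₂ l)) (AC.arc C)
          sameAs (k , k∋c) = k , λ { refl e → mk⇔
            (λ on → Equivalence.from terms-C (inHexagon-trans (pair⊆A c∈pair) (inHexagon-sym (base∈ (choose k)) k∋c)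
                (Equivalence.to (terms₂ k) on)))
            (λ on → Equivalence.from (terms₂ k) (inHexagon-trans (base∈ (choose k)) k∋c (Equivalence.to terms-C on))) }

    shared⇒saturated : ∀ {v} → Shared x y v → v ∈ saturated ⟨pair⟩
    shared⇒saturated (inj₁ (i , j , eq , eq′)) =
        saturated-induced {src∈S = src∈ ⟨pair⟩} {tgt∈S = tgt∈ ⟨pair⟩}
        (arcs⊆ ∘ pair⊆) pair-closed (x∈pair i) eq (y∈pair j) eq′
    shared⇒saturated (inj₂ (i , j , eq , eq′)) =
        saturated-induced {src∈S = src∈ ⟨pair⟩} {tgt∈S = tgt∈ ⟨pair⟩}
        (arcs⊆ ∘ pair⊆) pair-closed (y∈pair j) eq′ (x∈pair i) eq

    -- A shared vertex has both in-arcs in one hexagon and both out-arcs in the other, so it is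
    -- saturated in the subgraph of the two, which by assumption has at most two saturated vertices.
    few : ∀ {k} (S : Subset k) (v : Fin k → Fin (n G)) → Injective _≡_ _≡_ v →
          (∀ {i} → i ∈ S → Shared x y (v i)) → ∣ S ∣ ≤ 2
    few S v inj sh = ℕ.≤-trans (injection⇒∣p∣≤∣q∣ S (saturated ⟨pair⟩) v inj (shared⇒saturated ∘ sh))
      (ℕ.≮⇒≥ λ many → few-shared (pair , twoACs , many))

  Chosen : (Fin 3 → Bool) → Fin (m G) → Set
  Chosen c e = ∃[ x ] ∃[ i ] hex (base x) (c x) i ≡ e

  chosen? : ∀ c → Decidable (Chosen c)
  chosen? c e = Fin.any? λ x → Fin.any? λ i → hex (base x) (c x) i Fin.≟ e

  abstract
    chosen : (Fin 3 → Bool) → Subset (m G)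
    chosen c = ⟦ chosen? c ⟧

    Chosen⇒∈ : ∀ c {e} → Chosen c e → e ∈ chosen c
    Chosen⇒∈ c = ∈⟦⟧⁺ (chosen? c)

    ∈⇒Chosen : ∀ c {e} → e ∈ chosen c → Chosen c e
    ∈⇒Chosen c = ∈⟦⟧⁻ (chosen? c)

  chosen⊆ : ∀ c → chosen c ⊆ arcs
  chosen⊆ c e∈ with ∈⇒Chosen c e∈
  ... | x , i , refl = closed-hex arcs-closed (base∈ x) (base∈F x) (c x) i

  ∈chosen⁺ : ∀ c {x b i e} → hex (base x) b i ≡ e → b ≡ c x → e ∈ chosen c
  ∈chosen⁺ c {x} {b} {i} eq refl = Chosen⇒∈ c (x , i , eq)

  ∈chosen⁻ : ∀ c {x b i e} → hex (base x) b i ≡ e → e ∈ chosen c → b ≡ c x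
  ∈chosen⁻ c {x} {b} {i} refl e∈ with ∈⇒Chosen c e∈
  ... | y , j , eq with hex-unique {y} {c y} {j} {x} {b} {i} eq
  ... | refl , refl = refl

  chosen-alternating : ∀ c {e} → e ∈ arcs → AlternatingAt (chosen c) e
  chosen-alternating c e∈ with hexagons-cover e∈
  ... | x , b , i , refl = record
    { o-leaves = λ e∈c oe∈c → not-fixed (trans (∈chosen⁻ c {x} o-eq oe∈c) (sym (∈chosen⁻ c {x} {b} {i} refl e∈c)))
    ; o-enters = λ e∉c → ∈chosen⁺ c {x} o-eq (not-≢ (e∉c ∘ ∈chosen⁺ c {x} {b} {i} refl))
    ; p-leaves = λ e∈c pe∈c → not-fixed (trans (∈chosen⁻ c {x} p-eq pe∈c) (sym (∈chosen⁻ c {x} {b} {i} refl e∈c)))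
    ; p-enters = λ e∉c → ∈chosen⁺ c {x} p-eq (not-≢ (e∉c ∘ ∈chosen⁺ c {x} {b} {i} refl))
    }
    where
    p-eq : hex (base x) (not b) i ≡ p (hex (base x) b i)
    p-eq = sym (p-hex (base∈ x) b i)
    o-index : Bool → Fin 3
    o-index true  = succ₃ i
    o-index false = pred₃ i
    o-eq : hex (base x) (not b) (o-index b) ≡ o (hex (base x) b i)
    o-eq = eq b
      where
      eq : ∀ b → hex (base x) (not b) (o-index b) ≡ o (hex (base x) b i)
      eq true  = sym (o-hex-true (base∈ x) i)
      eq false = sym (o-hex-false (base∈ x) i)

  circulating⇒circulation : ∀ c {P} → Circulating G (chosen c) P → Circulation c
  circulating⇒circulation c {P} ((e , e∈P) , P⊆ , after , before) = record
    { Pass  = λ x i → hex (base x) (c x) i ∈ P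
    ; some  = let x , i , e∈ = locate e∈P in x , i , subst (_∈ P) (sym e∈) e∈P
    ; forth = λ {x} {i} pass → let e′ , e′∈ , eq = after _ pass
                                   y , j , eq′ = locate e′∈ in
        y , j , subst (_∈ P) (sym eq′) e′∈ ,
        trans (sym (tgt-hex (base∈ x) (c x) i)) (trans eq (trans (cong (src G) (sym eq′)) (src-hex (base∈ y) (c y) j)))
    ; back  = λ {y} {j} pass → let e′ , e′∈ , eq = before _ pass
                                   x , i , eq′ = locate e′∈ in
        x , i , subst (_∈ P) (sym eq′) e′∈ ,
        trans (sym (tgt-hex (base∈ x) (c x) i)) (trans (cong (tgt G) eq′) (trans eq (src-hex (base∈ y) (c y) j)))
    }
    where
    locate : ∀ {e} → e ∈ P → Chosen c e
    locate e∈ = ∈⇒Chosen c (P⊆ e∈)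

  IsAcyclicChoice : Subset (m G) → Set
  IsAcyclicChoice f = f ⊆ arcs × (∀ {e} → e ∈ arcs → AlternatingAt f e) × Acyclic G f

  acyclic-choice : ∃ IsAcyclicChoice
  -- A subset of `Fin 3` is a vector of three Booleans, read here as the sides chosen in the three
  -- hexagons.
  acyclic-choice = decide (anySubset? λ c → acyclic? G (chosen (lookup c)))
    where
    decide : Dec (∃[ c ] Acyclic G (chosen (lookup c))) → ∃ IsAcyclicChoice
    decide (yes (c , acyclic)) = chosen (lookup c) , chosen⊆ (lookup c) , chosen-alternating (lookup c) , acyclic
    decide (no none) = contradiction
      (λ c → circulating⇒circulation (lookup c) (proj₂ (cyclic c)))
      (all-circulate-impossible (λ {x} {y} → Pair.few))
      where
      cyclic : ∀ c → ∃ (Circulating G (chosen (lookup c)))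
      cyclic c = decidable-stable (circulating? G (chosen (lookup c))) λ acyclic → none (c , acyclic)

-- Paths along an acyclic set of arcs.

x∈p─q⇒x∉q : ∀ {n} {x} (p q : Subset n) → x ∈ p ─ q → x ∉ q
x∈p─q⇒x∉q (inside ∷ p)  (outside ∷ q) here       ()
x∈p─q⇒x∉q (_ ∷ p)       (outside ∷ q) (there x∈) (there x∈q) = x∈p─q⇒x∉q p q x∈ x∈q
x∈p─q⇒x∉q (_ ∷ p)       (inside ∷ q)  (there x∈) (there x∈q) = x∈p─q⇒x∉q p q x∈ x∈q

-- Two runs from `x` of a deterministic relation agree step by step, so neither can go on where the
-- other is stuck.
stuck-unique : ∀ {A : Set} {R : A → A → Set} → (∀ {x y z} → R x y → R x z → y ≡ z) →
               ∀ {x y z} → Star R x y → (∀ {w} → ¬ R y w) → Star R x z → (∀ {w} → ¬ R z w) → y ≡ z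
stuck-unique det ε       stuck ε        stuck′ = refl
stuck-unique det ε       stuck (r ◅ _)  stuck′ = contradiction r stuck
stuck-unique det (r ◅ _) stuck ε        stuck′ = contradiction r stuck′
stuck-unique det (r ◅ p) stuck (r′ ◅ q) stuck′ with det r r′
... | refl = stuck-unique det p stuck q stuck′

∃∈-≡ : ∀ {n} {S : Subset n} {u v : ∃[ x ] x ∈ S} → proj₁ u ≡ proj₁ v → u ≡ v
∃∈-≡ {u = _ , p} {_ , q} refl = cong (_ ,_) ([]=-irrelevant p q)

onSequence? : ∀ {k n} (arc : Fin k → Fin n) → Decidable (λ e → ∃[ i ] arc i ≡ e)
onSequence? arc e = Fin.any? λ i → arc i Fin.≟ e

cyclic⇒circulating : ∀ G f {k} (arc : Fin (suc k) → Fin (m G)) → (∀ i → arc i ∈ f) →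
  (∀ i → tgt G (arc i) ≡ src G (arc (next i))) → ∃ (Circulating G f)
cyclic⇒circulating G f arc arc∈ consecutive = ⟦ onSequence? arc ⟧ ,
  (arc zero , member zero) ,
  (λ e∈ → let i , eq = ∈⟦⟧⁻ (onSequence? arc) e∈ in subst (_∈ f) eq (arc∈ i)) ,
  (λ e e∈ → let i , eq = ∈⟦⟧⁻ (onSequence? arc) e∈ in
    arc (next i) , member (next i) , trans (cong (tgt G) (sym eq)) (consecutive i)) ,
  (λ e e∈ → let i , eq = ∈⟦⟧⁻ (onSequence? arc) e∈
                j , eq′ = next-surjective i in
    arc j , member j , trans (consecutive j) (cong (src G) (trans (cong arc eq′) eq)))
  where
  member : ∀ i → arc i ∈ ⟦ onSequence? arc ⟧
  member i = ∈⟦⟧⁺ (onSequence? arc) (i , refl)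

cycle-circulates : ∀ G f (C : Cycle G) → (∀ i → Cycle.arc C i ∈ f) → ∃ (Circulating G f)
cycle-circulates G f record { len = suc _ ; arc = arc ; consecutive = consecutive } arc∈ =
  cyclic⇒circulating G f arc arc∈ consecutive

module Steps (G : Digraph) (f : Subset (m G)) where

  Step : Fin (n G) → Fin (n G) → Set
  Step u v = ∃[ e ] e ∈ f × src G e ≡ u × tgt G e ≡ v

  -- For acyclic `f` this is a strict order on a finite set, hence well founded in both directions;
  -- that is why following arcs of `f` backwards or forwards must end.
  Path⁺ : Fin (n G) → Fin (n G) → Set
  Path⁺ = TransClosure Step

  On : ∀ {u v} → Path⁺ u v → Fin (m G) → Set
  On [ e , _ ]       x = x ≡ e
  On ((e , _) ∷ p) x = x ≡ e ⊎ On p x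

  on? : ∀ {u v} (p : Path⁺ u v) → Decidable (On p)
  on? [ e , _ ]       x = x Fin.≟ e
  on? ((e , _) ∷ p) x = (x Fin.≟ e) ⊎-dec on? p x

  on⊆ : ∀ {u v} (p : Path⁺ u v) {x} → On p x → x ∈ f
  on⊆ [ _ , e∈ , _ ]       refl        = e∈
  on⊆ ((_ , e∈ , _) ∷ p) (inj₁ refl) = e∈
  on⊆ (_ ∷ p)            (inj₂ on)   = on⊆ p on

  first : ∀ {u v} (p : Path⁺ u v) → ∃[ x ] On p x × src G x ≡ u
  first [ e , _ , eq , _ ]       = e , refl , eq
  first ((e , _ , eq , _) ∷ p) = e , inj₁ refl , eq

  last : ∀ {u v} (p : Path⁺ u v) → ∃[ x ] On p x × tgt G x ≡ v
  last [ e , _ , _ , eq ] = e , refl , eq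
  last (_ ∷ p)          = let x , on , eq = last p in x , inj₂ on , eq

  following : ∀ {u v} (p : Path⁺ u v) {x} → On p x → (∃[ y ] On p y × tgt G x ≡ src G y) ⊎ tgt G x ≡ v
  following [ _ , _ , _ , eq ]       refl        = inj₂ eq
  following ((_ , _ , _ , eq) ∷ p) (inj₁ refl) = let y , on , eq′ = first p in inj₁ (y , inj₂ on , trans eq (sym eq′))
  following (_ ∷ p)                (inj₂ on) with following p on
  ... | inj₁ (y , on′ , eq) = inj₁ (y , inj₂ on′ , eq)
  ... | inj₂ eq             = inj₂ eq

  preceding : ∀ {u v} (p : Path⁺ u v) {x} → On p x → (∃[ y ] On p y × tgt G y ≡ src G x) ⊎ src G x ≡ u
  preceding [ _ , _ , eq , _ ]       refl        = inj₂ eq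
  preceding ((_ , _ , eq , _) ∷ p) (inj₁ refl) = inj₂ eq
  preceding ((e , _ , _ , eq) ∷ p) (inj₂ on) with preceding p on
  ... | inj₁ (y , on′ , eq′) = inj₁ (y , inj₂ on′ , eq′)
  ... | inj₂ eq′             = inj₁ (e , inj₁ refl , trans eq (sym eq′))

  closed-path-circulates : ∀ {v} → Path⁺ v v → ∃ (Circulating G f)
  closed-path-circulates p = ⟦ on? p ⟧ ,
    (let x , on , _ = first p in x , ∈⟦⟧⁺ (on? p) on) ,
    (λ x∈ → on⊆ p (∈⟦⟧⁻ (on? p) x∈)) ,
    (λ x x∈ → after (following p (∈⟦⟧⁻ (on? p) x∈))) ,
    (λ x x∈ → before (preceding p (∈⟦⟧⁻ (on? p) x∈)))
    where
    after : ∀ {x} → _ → ∃[ y ] y ∈ ⟦ on? p ⟧ × tgt G x ≡ src G y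
    after (inj₁ (y , on , eq)) = y , ∈⟦⟧⁺ (on? p) on , eq
    after (inj₂ eq) = let y , on , eq′ = first p in y , ∈⟦⟧⁺ (on? p) on , trans eq (sym eq′)
    before : ∀ {x} → _ → ∃[ y ] y ∈ ⟦ on? p ⟧ × tgt G y ≡ src G x
    before (inj₁ (y , on , eq)) = y , ∈⟦⟧⁺ (on? p) on , eq
    before (inj₂ eq) = let y , on , eq′ = last p in y , ∈⟦⟧⁺ (on? p) on , trans eq′ (sym eq)

  Initial Terminal : Fin (n G) → Set
  Initial  v = ¬ (∃[ e ] e ∈ f × tgt G e ≡ v)
  Terminal v = ¬ (∃[ e ] e ∈ f × src G e ≡ v)

  module _ (acyclic : Acyclic G f) where

    private
      isSPO : IsStrictPartialOrder _≡_ Path⁺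
      isSPO = record
        { isEquivalence = isEquivalence
        ; irrefl        = λ { refl p → acyclic (closed-path-circulates p) }
        ; trans         = _++_
        ; <-resp-≈      = (λ { refl p → p }) , (λ { refl p → p })
        }

      back-to-initial : ∀ v → Acc Path⁺ v → ∃[ u ] Star Step u v × Initial u
      back-to-initial v (acc rs) with Fin.any? (λ e → (e ∈? f) ×-dec (tgt G e Fin.≟ v))
      ... | no  initial       = v , ε , initial
      ... | yes (e , e∈ , eq) = let u , path , initial = back-to-initial (src G e) (rs [ e , e∈ , refl , eq ]) in
        u , path ◅◅ (e , e∈ , refl , eq) ◅ ε , initial

      on-to-terminal : ∀ v → Acc (flip Path⁺) v → ∃[ u ] Star Step v u × Terminal u
      on-to-terminal v (acc rs) with Fin.any? (λ e → (e ∈? f) ×-dec (src G e Fin.≟ v))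
      ... | no  terminal      = v , ε , terminal
      ... | yes (e , e∈ , eq) = let u , path , terminal = on-to-terminal (tgt G e) (rs [ e , e∈ , eq , refl ]) in
        u , (e , e∈ , eq , refl) ◅ path , terminal

    abstract
      origin : ∀ v → ∃[ u ] Star Step u v × Initial u
      origin v = back-to-initial v (spo-wellFounded isSPO v)

      destination : ∀ v → ∃[ u ] Star Step v u × Terminal u
      destination v = on-to-terminal v (spo-noetherian isSPO v)

-- The collapse of F along an acyclic factor.

module CollapseAlong (G : Digraph) (dd : Is2dd G) (six : AllACsOfSize G 6) (F : Subgraph G)
  (closed-F : ∀ {e} → e ∈ A G → e ∈ Subgraph.arcs F →
              TwoRegular.o G dd e ∈ Subgraph.arcs F × TwoRegular.p G dd e ∈ Subgraph.arcs F)
  (f : Subset (m G)) (f⊆F : f ⊆ Subgraph.arcs F)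
  (alternating-f : ∀ {e} → e ∈ Subgraph.arcs F → TwoRegular.AlternatingAt G dd f e)
  (acyclic : Acyclic G f) where

  open ClosedSubsets G dd six
  open Subgraph F using (arcs; arcs⊆)
  open Steps G f

  f⊆A : f ⊆ A G
  f⊆A = arcs⊆ ∘ f⊆F

  -- The first and last vertex of the maximal path of `f` through `v`; both are `v` itself where `f`
  -- does not pass.
  root finish : Fin (n G) → Fin (n G)
  root   v = proj₁ (origin acyclic v)
  finish v = proj₁ (destination acyclic v)

  root-path : ∀ v → Star Step (root v) v
  root-path v = proj₁ (proj₂ (origin acyclic v))

  root-initial : ∀ v → Initial (root v)
  root-initial v = proj₂ (proj₂ (origin acyclic v))

  finish-path : ∀ v → Star Step v (finish v)
  finish-path v = proj₁ (proj₂ (destination acyclic v))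

  finish-terminal : ∀ v → Terminal (finish v)
  finish-terminal v = proj₂ (proj₂ (destination acyclic v))

  initial? : ∀ v → Dec (Initial v)
  initial? v = ¬? (Fin.any? λ e → (e ∈? f) ×-dec (tgt G e Fin.≟ v))

  private
    src-injective : ∀ {e e′} → e ∈ f → e′ ∈ f → src G e ≡ src G e′ → e ≡ e′
    src-injective e∈ e′∈ eq with src-only (f⊆A e∈) (f⊆A e′∈) (sym eq)
    ... | inj₁ same = sym same
    ... | inj₂ refl = contradiction e′∈ (AlternatingAt.p-leaves (alternating-f (f⊆F e∈)) e∈)

    tgt-injective : ∀ {e e′} → e ∈ f → e′ ∈ f → tgt G e ≡ tgt G e′ → e ≡ e′
    tgt-injective e∈ e′∈ eq with tgt-only (f⊆A e∈) (f⊆A e′∈) (sym eq)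
    ... | inj₁ same = sym same
    ... | inj₂ refl = contradiction e′∈ (AlternatingAt.o-leaves (alternating-f (f⊆F e∈)) e∈)

  root-unique : ∀ {u v} → Star Step u v → Initial u → root v ≡ u
  root-unique {v = v} path initial = stuck-unique {R = flip Step}
    (λ { (_ , e∈ , refl , eq) (_ , e′∈ , refl , eq′) → cong (src G) (tgt-injective e∈ e′∈ (trans eq (sym eq′))) })
    (reverse id (root-path v)) (λ { (e , e∈ , _ , eq) → root-initial v (e , e∈ , eq) })
    (reverse id path) (λ { (e , e∈ , _ , eq) → initial (e , e∈ , eq) })

  finish-unique : ∀ {u v} → Star Step u v → Terminal v → finish u ≡ v
  finish-unique {u} path terminal = stuck-unique {R = Step}
    (λ { (_ , e∈ , eq , refl) (_ , e′∈ , eq′ , refl) → cong (tgt G) (src-injective e∈ e′∈ (trans eq (sym eq′))) })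
    (finish-path u) (λ { (e , e∈ , eq , _) → finish-terminal u (e , e∈ , eq) })
    path (λ { (e , e∈ , eq , _) → terminal (e , e∈ , eq) })

  root-path-invariant : ∀ {u v} → Star Step u v → root v ≡ root u
  root-path-invariant {u} path = root-unique (root-path u ◅◅ path) (root-initial u)

  finish-path-invariant : ∀ {u v} → Star Step u v → finish u ≡ finish v
  finish-path-invariant {v = v} path = finish-unique (path ◅◅ finish-path v) (finish-terminal v)

  root-of-initial : ∀ {v} → Initial v → root v ≡ v
  root-of-initial = root-unique ε

  finish-of-terminal : ∀ {v} → Terminal v → finish v ≡ v
  finish-of-terminal = finish-unique ε

  root-finish : ∀ {v} → Initial v → root (finish v) ≡ v
  root-finish {v} initial = trans (root-path-invariant (finish-path v)) (root-of-initial initial)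

  finish-root : ∀ {v} → Terminal v → finish (root v) ≡ v
  finish-root {v} terminal = trans (finish-path-invariant (root-path v)) (finish-of-terminal terminal)

  path-start∈V : ∀ {u v} → Star Step u v → v ∈ V G → u ∈ V G
  path-start∈V ε                      v∈ = v∈
  path-start∈V ((_ , e∈ , refl , _) ◅ _) v∈ = src∈ G (f⊆A e∈)

  path-end∈V : ∀ {u v} → Star Step u v → u ∈ V G → v ∈ V G
  path-end∈V ε                         u∈ = u∈
  path-end∈V ((_ , e∈ , _ , refl) ◅ p) u∈ = path-end∈V p (tgt∈ G (f⊆A e∈))

  f-out : ∀ {e} → e ∈ arcs → ∃[ e′ ] e′ ∈ f × src G e′ ≡ src G e
  f-out {e} e∈ with e ∈? f
  ... | yes e∈f = e , e∈f , refl
  ... | no  e∉f = p e , AlternatingAt.p-enters (alternating-f e∈) e∉f , src-p (arcs⊆ e∈)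

  f-in : ∀ {e} → e ∈ arcs → ∃[ e′ ] e′ ∈ f × tgt G e′ ≡ tgt G e
  f-in {e} e∈ with e ∈? f
  ... | yes e∈f = e , e∈f , refl
  ... | no  e∉f = o e , AlternatingAt.o-enters (alternating-f e∈) e∉f , tgt-o (arcs⊆ e∈)

  A′ : Subset (m G)
  A′ = A G ─ arcs

  A′⊆A : A′ ⊆ A G
  A′⊆A = p─q⊆p (A G) arcs

  A′∌ : ∀ {e} → e ∈ A′ → e ∉ arcs
  A′∌ = x∈p─q⇒x∉q (A G) arcs

  ∈A′ : ∀ {e} → e ∈ A G → e ∉ arcs → e ∈ A′
  ∈A′ = x∈p∧x∉q⇒x∈p─q

  closed-A′ : Closed (_∈ A′)
  closed-A′ {e} e∈ e∈A′ =
    ∈A′ (o∈ e∈) (λ oe∈ → A′∌ e∈A′ (subst (_∈ arcs) (o-involutive e∈) (proj₁ (closed-F (o∈ e∈) oe∈)))) ,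
    ∈A′ (p∈ e∈) (λ pe∈ → A′∌ e∈A′ (subst (_∈ arcs) (p-involutive e∈) (proj₂ (closed-F (p∈ e∈) pe∈))))

  -- Arcs with a common start lie in the same alternating cycle, so where an outer arc starts, no
  -- arc of F does.
  src-terminal : ∀ {e} → e ∈ A′ → Terminal (src G e)
  src-terminal e∈ (x , x∈ , eq) = A′∌ e∈ (out-all arcs⊆ closed-F (f⊆F x∈) (A′⊆A e∈) (sym eq))

  tgt-initial : ∀ {e} → e ∈ A′ → Initial (tgt G e)
  tgt-initial e∈ (x , x∈ , eq) = A′∌ e∈ (in-all arcs⊆ closed-F (f⊆F x∈) (A′⊆A e∈) (sym eq))

  in-A′ : ∀ {e v} → e ∈ A G → tgt G e ≡ v → Initial v → e ∈ A′
  in-A′ e∈ refl initial = ∈A′ e∈ λ e∈F → let x , x∈ , eq = f-in e∈F in initial (x , x∈ , eq)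

  out-A′ : ∀ {e v} → e ∈ A G → src G e ≡ v → Terminal v → e ∈ A′
  out-A′ e∈ refl terminal = ∈A′ e∈ λ e∈F → let x , x∈ , eq = f-out e∈F in terminal (x , x∈ , eq)

  kept? : Decidable (λ v → v ∈ V G × Initial v)
  kept? v = (v ∈? V G) ×-dec initial? v

  -- An exit of F is represented by the entry at which its path begins. Vertices saturated in F are
  -- entered by `f` and drop out; vertices that F does not touch are initial and stay. The arc
  -- labels are those of `G`, so a factor of `G′` is at once a set of arcs of `G`.
  G′ : Digraph
  G′ = record
    { n    = n G
    ; m    = m G
    ; V    = ⟦ kept? ⟧
    ; A    = A′
    ; src  = root ∘ src G
    ; tgt  = tgt G
    ; src∈ = λ {e} e∈ → ∈⟦⟧⁺ kept? (path-start∈V (root-path (src G e)) (src∈ G (A′⊆A e∈)) , root-initial (src G e))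
    ; tgt∈ = λ e∈ → ∈⟦⟧⁺ kept? (tgt∈ G (A′⊆A e∈) , tgt-initial e∈)
    }

  -- An outer arc starts at the end of its path of `f`, and `finish` recovers that end from the
  -- root.
  src′-reflects : ∀ {e e′} → e ∈ A′ → e′ ∈ A′ → root (src G e) ≡ root (src G e′) → src G e ≡ src G e′
  src′-reflects e∈ e′∈ eq = trans (sym (finish-root (src-terminal e∈))) (trans (cong finish eq) (finish-root (src-terminal e′∈)))

  G′-saturated : ∀ {v} → v ∈ V G′ → v ∈ saturated G′
  G′-saturated {v} v∈ = ∈verticesOfDegree⁺ G′ (2 , 2) v∈ (cong₂ _,_ indeg′ outdeg′)
    where
    v∈V : v ∈ V G
    v∈V = proj₁ (∈⟦⟧⁻ kept? v∈)
    initial : Initial v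
    initial = proj₂ (∈⟦⟧⁻ kept? v∈)
    indeg′ : indeg G′ v ≡ 2
    indeg′ = trans (cong ∣_∣ (⟦⟧-cong (arcsWithEnd? G′ (tgt G′) v) (arcsWithEnd? G (tgt G) v) λ e →
      mk⇔ (λ (e∈ , eq) → A′⊆A e∈ , eq) (λ (e∈ , eq) → in-A′ e∈ eq initial , eq))) (indeg≡2 v∈V)
    outdeg′ : outdeg G′ v ≡ 2
    -- The out-arcs of `v` in `G′` are those that leave the far end of its path in `G`.
    outdeg′ = trans (cong ∣_∣ (⟦⟧-cong (arcsWithEnd? G′ (src G′) v) (arcsWithEnd? G (src G) (finish v)) λ e → mk⇔
      (λ (e∈ , eq) → A′⊆A e∈ , trans (sym (finish-root (src-terminal e∈))) (cong finish eq))
      (λ (e∈ , eq) → out-A′ e∈ eq (finish-terminal v) , trans (cong root eq) (root-finish initial))))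
      (outdeg≡2 (path-end∈V (finish-path v) v∈V))

  G′-2dd : Is2dd G′
  G′-2dd = (λ v∈ → inj₂ (inj₂ (G′-saturated v∈))) , G′-saturated

  G′-AC : (C : AC G) → (∀ i → AC.arc C i ∈ A′) → AC G′
  G′-AC C arc∈ = AC-map {G} {G′} id id (λ _ _ → id) (λ _ _ → cong root) C arc∈

  G-AC : AC G′ → AC G
  G-AC C = AC-map {G′} {G} id id (λ _ _ → id) src′-reflects C (A′⊆A ∘ AC.arc∈ C)

  G′-six : AllACsOfSize G′ 6
  G′-six C = six (G-AC C)

  factor-f : Factor ⟨ F ⟩
  factor-f = record
    { arcs    = f
    ; arcs⊆   = f⊆F
    ; oneSide = λ C → alternating⇒oneSide (embed arcs⊆ C) (λ i → alternating-f (AC.arc∈ C i))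
    }

  factor-f-open : IsOpen factor-f
  factor-f-open record { len = suc _ ; arc = arc ; arc∈ = arc∈ ; consecutive = consecutive } =
    acyclic (cyclic⇒circulating G f arc arc∈ consecutive)

  Entry Exit : Fin (n G) → Set
  Entry v = (∃[ e ] e ∈ arcs × src G e ≡ v) × (∀ e → ¬ (e ∈ arcs × tgt G e ≡ v))
  Exit  v = (∃[ e ] e ∈ arcs × tgt G e ≡ v) × (∀ e → ¬ (e ∈ arcs × src G e ≡ v))

  entries⇒Entry : ∀ {v} → v ∈ entries ⟨ F ⟩ → Entry v
  entries⇒Entry {v} v∈ =
    (let e , _ , _ , e∈ , _ = ∣p∣≡2⇒pair ⟦ arcsWithEnd? ⟨ F ⟩ (src G) v ⟧ (cong proj₂ degrees) in
     e , ∈⟦⟧⁻ (arcsWithEnd? ⟨ F ⟩ (src G) v) e∈) ,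
    (λ e e∈ → ∣p∣≡0⇒∉ ⟦ arcsWithEnd? ⟨ F ⟩ (tgt G) v ⟧ (cong proj₁ degrees) e (∈⟦⟧⁺ (arcsWithEnd? ⟨ F ⟩ (tgt G) v) e∈))
    where degrees = proj₂ (∈verticesOfDegree⁻ ⟨ F ⟩ (0 , 2) v∈)

  exits⇒Exit : ∀ {v} → v ∈ exits ⟨ F ⟩ → Exit v
  exits⇒Exit {v} v∈ =
    (let e , _ , _ , e∈ , _ = ∣p∣≡2⇒pair ⟦ arcsWithEnd? ⟨ F ⟩ (tgt G) v ⟧ (cong proj₁ degrees) in
     e , ∈⟦⟧⁻ (arcsWithEnd? ⟨ F ⟩ (tgt G) v) e∈) ,
    (λ e e∈ → ∣p∣≡0⇒∉ ⟦ arcsWithEnd? ⟨ F ⟩ (src G) v ⟧ (cong proj₂ degrees) e (∈⟦⟧⁺ (arcsWithEnd? ⟨ F ⟩ (src G) v) e∈))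
    where degrees = proj₂ (∈verticesOfDegree⁻ ⟨ F ⟩ (2 , 0) v∈)

  Entry⇒entries : ∀ {v} → Entry v → v ∈ entries ⟨ F ⟩
  Entry⇒entries {v} ((e , e∈ , eq) , none) = ∈verticesOfDegree⁺ ⟨ F ⟩ (0 , 2)
    (subst (_∈ V ⟨ F ⟩) eq (src∈ ⟨ F ⟩ e∈))
    (cong₂ _,_ (∣⟦none⟧∣≡0 (arcsWithEnd? ⟨ F ⟩ (tgt G) v) none)
        (outdeg-induced {src∈S = src∈ ⟨ F ⟩} {tgt∈S = tgt∈ ⟨ F ⟩} arcs⊆ closed-F e∈ eq))

  Exit⇒exits : ∀ {v} → Exit v → v ∈ exits ⟨ F ⟩
  Exit⇒exits {v} ((e , e∈ , eq) , none) = ∈verticesOfDegree⁺ ⟨ F ⟩ (2 , 0)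
    (subst (_∈ V ⟨ F ⟩) eq (tgt∈ ⟨ F ⟩ e∈))
    (cong₂ _,_ (indeg-induced {src∈S = src∈ ⟨ F ⟩} {tgt∈S = tgt∈ ⟨ F ⟩} arcs⊆ closed-F e∈ eq)
        (∣⟦none⟧∣≡0 (arcsWithEnd? ⟨ F ⟩ (src G) v) none))

  Entry-initial : ∀ {v} → Entry v → Initial v
  Entry-initial (_ , none) (e , e∈ , eq) = none e (f⊆F e∈ , eq)

  Exit-terminal : ∀ {v} → Exit v → Terminal v
  Exit-terminal (_ , none) (e , e∈ , eq) = none e (f⊆F e∈ , eq)

  private
    first-step : ∀ {u v} → Star Step u v → u ≡ v ⊎ ∃[ e ] e ∈ f × src G e ≡ u
    first-step ε                         = inj₁ refl
    first-step ((e , e∈ , eq , _) ◅ _) = inj₂ (e , e∈ , eq)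

    last-step : ∀ {u v} → Star Step u v → u ≡ v ⊎ ∃[ e ] e ∈ f × tgt G e ≡ v
    last-step ε = inj₁ refl
    last-step ((e , e∈ , _ , eq) ◅ path) with last-step path
    ... | inj₁ refl = inj₂ (e , e∈ , eq)
    ... | inj₂ last = inj₂ last

  finish-Exit : ∀ {v} → Entry v → Exit (finish v)
  finish-Exit {v} ((e , e∈ , eq) , _) = entered (last-step (finish-path v)) ,
    λ e (e∈ , eq) → let x , x∈ , eq′ = f-out e∈ in finish-terminal v (x , x∈ , trans eq′ eq)
    where
    entered : v ≡ finish v ⊎ (∃[ e ] e ∈ f × tgt G e ≡ finish v) → ∃[ e ] e ∈ arcs × tgt G e ≡ finish v
    entered (inj₂ (x , x∈ , eq′)) = x , f⊆F x∈ , eq′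
    entered (inj₁ same) = let x , x∈ , eq′ = f-out e∈ in
      contradiction (x , x∈ , trans eq′ (trans eq same)) (finish-terminal v)

  root-Entry : ∀ {v} → Exit v → Entry (root v)
  root-Entry {v} ((e , e∈ , eq) , _) = left (first-step (root-path v)) ,
    λ e (e∈ , eq) → let x , x∈ , eq′ = f-in e∈ in root-initial v (x , x∈ , trans eq′ eq)
    where
    left : root v ≡ v ⊎ (∃[ e ] e ∈ f × src G e ≡ root v) → ∃[ e ] e ∈ arcs × src G e ≡ root v
    left (inj₂ (x , x∈ , eq′)) = x , f⊆F x∈ , eq′
    left (inj₁ same) = let x , x∈ , eq′ = f-in e∈ in
      contradiction (x , x∈ , trans eq′ (trans eq (sym same))) (root-initial v)

  route : EntryVertex ⟨ F ⟩ ↔ ExitVertex ⟨ F ⟩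
  route = mk↔ₛ′
    (λ (u , u∈) → finish u , Exit⇒exits (finish-Exit (entries⇒Entry u∈)))
    (λ (v , v∈) → root v , Entry⇒entries (root-Entry (exits⇒Exit v∈)))
    (λ (v , v∈) → ∃∈-≡ (finish-root (Exit-terminal (exits⇒Exit v∈))))
    (λ (u , u∈) → ∃∈-≡ (root-finish (Entry-initial (entries⇒Entry u∈))))

  route-open : IsOpenRoute ⟨ F ⟩ route
  route-open = factor-f , factor-f-open , λ (u , _) → finish-path u

  isEndOf? : ∀ S → Decidable (λ v → ∃[ e ] e ∈ S × (src G e ≡ v ⊎ tgt G e ≡ v))
  isEndOf? S v = Fin.any? λ e → (e ∈? S) ×-dec ((src G e Fin.≟ v) ⊎-dec (tgt G e Fin.≟ v))

  complement-end : ∀ {v} → v ∈ V (complement F) → ∃[ e ] e ∈ A′ × (src G e ≡ v ⊎ tgt G e ≡ v)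
  complement-end = ∈⟦⟧⁻ (isEndOf? A′)

  complement-vertex : ∀ {v} → v ∈ V (complement F) → v ∈ V G
  complement-vertex v∈ with complement-end v∈
  ... | e , e∈ , inj₁ refl = src∈ G (A′⊆A e∈)
  ... | e , e∈ , inj₂ refl = tgt∈ G (A′⊆A e∈)

  -- A vertex of the complement that `f` enters can only be the start of an outer arc; it is then an
  -- exit of F, joined to its root by the route. If `f` does not enter it, it is its own root.
  ∼root : ∀ {v} → v ∈ V (complement F) → EqClosure (CollapseRel F route) v (root v)
  ∼root {v} v∈ = decide (Fin.any? λ e → (e ∈? f) ×-dec (tgt G e Fin.≟ v))
    where
    decide : Dec (∃[ e ] e ∈ f × tgt G e ≡ v) → EqClosure (CollapseRel F route) v (root v)
    decide (no initial) = subst (EqClosure (CollapseRel F route) v) (sym (root-of-initial initial)) ε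
    decide (yes (e , e∈ , eq)) = leaving (complement-end v∈)
      where
      leaving : ∃[ e ] e ∈ A′ × (src G e ≡ v ⊎ tgt G e ≡ v) → EqClosure (CollapseRel F route) v (root v)
      leaving (x , x∈ , inj₂ refl) = contradiction (e , e∈ , eq) (tgt-initial x∈)
      leaving (x , x∈ , inj₁ refl) = subst (λ w → EqClosure (CollapseRel F route) w (root v)) (finish-root (Exit-terminal exit))
        (bwd (entry∼exit (root v , Entry⇒entries (root-Entry exit))) ◅ ε)
        where
        exit : Exit v
        exit = (e , f⊆F e∈ , eq) , λ y (y∈ , eq) → let z , z∈ , eq′ = f-out y∈ in src-terminal x∈ (z , z∈ , trans eq′ eq)

  root-respects : ∀ {u v} → EqClosure (CollapseRel F route) u v → root u ≡ root v
  root-respects = gfold isEquivalence root λ { (entry∼exit (u , _)) → sym (root-path-invariant (finish-path u)) }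

  gluing : IsGluing (complement F) (CollapseRel F route) G′
  gluing = record
    { vmap      = root
    ; vmap∈     = λ {v} v∈ → ∈⟦⟧⁺ kept? (path-start∈V (root-path v) (complement-vertex v∈) , root-initial v)
    ; vmap-surj = λ {w} w∈ → let w∈V , initial = ∈⟦⟧⁻ kept? w∈
                                 e , e∈ , eq = inArc w∈V in
        w , subst (_∈ V (complement F)) eq (tgt∈ (complement F) (in-A′ e∈ eq initial)) , root-of-initial initial
    ; vmap-ker  = λ u∈ v∈ → mk⇔
        (λ eq → ∼root u∈ ◅◅ subst (λ w → EqClosure (CollapseRel F route) w _) (sym eq) (Eq.symmetric _ (∼root v∈)))
        root-respects
    ; amap      = id
    ; amap∈     = id
    ; amap-inj  = λ _ _ → id
    ; amap-surj = λ {e} e∈ → e , e∈ , refl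
    ; src-amap  = λ _ → refl
    ; tgt-amap  = λ e∈ → sym (root-of-initial (tgt-initial e∈))
    }

  isCollapse : IsCollapse F G′
  isCollapse = route , route-open , gluing

  -- Factors of the collapse extended by `f` to factors of `G`.

  module WithOuter {q : Subset (m G)} (q⊆A′ : q ⊆ A′) (alternating-q : ∀ {e} → e ∈ A′ → AlternatingAt q e) where

    T : Subset (m G)
    T = q ∪ f

    T⊆A : T ⊆ A G
    T⊆A e∈ = [ A′⊆A ∘ q⊆A′ , f⊆A ]′ (x∈p∪q⁻ q f e∈)

    q⊆T : q ⊆ T
    q⊆T e∈ = x∈p∪q⁺ {p = q} {q = f} (inj₁ e∈)

    f⊆T : f ⊆ T
    f⊆T e∈ = x∈p∪q⁺ {p = q} {q = f} (inj₂ e∈)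

    T∩A′⊆q : ∀ {e} → e ∈ A′ → e ∈ T → e ∈ q
    T∩A′⊆q e∈A′ e∈ = [ id , (λ e∈f → contradiction (f⊆F e∈f) (A′∌ e∈A′)) ]′ (x∈p∪q⁻ q f e∈)

    T∩F⊆f : ∀ {e} → e ∈ arcs → e ∈ T → e ∈ f
    T∩F⊆f e∈F e∈ = [ (λ e∈q → contradiction e∈F (A′∌ (q⊆A′ e∈q))) , id ]′ (x∈p∪q⁻ q f e∈)

    alternating-T : Alternating T
    alternating-T {e} e∈ with e ∈? arcs
    ... | yes e∈F = record
      { o-leaves = λ e∈T oe∈T → o-leaves (T∩F⊆f e∈F e∈T) (T∩F⊆f (proj₁ (closed-F e∈ e∈F)) oe∈T)
      ; o-enters = λ e∉T → f⊆T (o-enters (e∉T ∘ f⊆T))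
      ; p-leaves = λ e∈T pe∈T → p-leaves (T∩F⊆f e∈F e∈T) (T∩F⊆f (proj₂ (closed-F e∈ e∈F)) pe∈T)
      ; p-enters = λ e∉T → f⊆T (p-enters (e∉T ∘ f⊆T))
      } where open AlternatingAt (alternating-f e∈F)
    ... | no  e∉F = record
      { o-leaves = λ e∈T oe∈T → o-leaves (T∩A′⊆q e∈A′ e∈T) (T∩A′⊆q (proj₁ (closed-A′ e∈ e∈A′)) oe∈T)
      ; o-enters = λ e∉T → q⊆T (o-enters (e∉T ∘ q⊆T))
      ; p-leaves = λ e∈T pe∈T → p-leaves (T∩A′⊆q e∈A′ e∈T) (T∩A′⊆q (proj₂ (closed-A′ e∈ e∈A′)) pe∈T)
      ; p-enters = λ e∉T → q⊆T (p-enters (e∉T ∘ q⊆T))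
      } where e∈A′ = ∈A′ e∈ e∉F
              open AlternatingAt (alternating-q e∈A′)

    factor-T : Factor G
    factor-T = record
      { arcs    = T
      ; arcs⊆   = T⊆A
      ; oneSide = λ C → alternating⇒oneSide C (λ i → alternating-T (AC.arc∈ C i))
      }

    K L : Digraph
    K = spanning G T T⊆A
    L = spanning G′ q q⊆A′

    T-out : ∀ {v} → v ∈ V G → ∃[ e ] e ∈ T × src G e ≡ v
    T-out v∈ with outArc v∈
    ... | e , e∈ , eq with e ∈? T
    ... | yes e∈T = e , e∈T , eq
    ... | no  e∉T = p e , AlternatingAt.p-enters (alternating-T e∈) e∉T , trans (src-p e∈) eq

    q-out : ∀ {v} → v ∈ V G → Terminal v → ∃[ e ] e ∈ q × src G e ≡ v
    q-out v∈ terminal = let e , e∈ , eq = T-out v∈ in e , T∩A′⊆q (out-A′ (T⊆A e∈) eq terminal) e∈ , eq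

    coverK : CycleCover K
    coverK = alternating⇒cycleCover T⊆A alternating-T

    coverL : CycleCover L
    coverL = record
      { after         = λ {e} e∈ →
          let t = finish (tgt G e)
              x , x∈ , eq = q-out (path-end∈V (finish-path (tgt G e)) (tgt∈ G (A′⊆A (q⊆A′ e∈)))) (finish-terminal (tgt G e)) in
          x , x∈ , sym (trans (cong root eq) (root-finish (tgt-initial (q⊆A′ e∈))))
      ; src-injective = λ e∈ e′∈ eq → CycleCover.src-injective coverK (q⊆T e∈) (q⊆T e′∈) (src′-reflects (q⊆A′ e∈) (q⊆A′ e′∈) eq)
      ; tgt-injective = λ e∈ e′∈ eq → CycleCover.tgt-injective coverK (q⊆T e∈) (q⊆T e′∈) eq
      }

    along-path : ∀ {e v e′} → e ∈ T → Star Step (tgt G e) v → e′ ∈ T → src G e′ ≡ v → Reach K e e′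
    along-path e∈ ε                          e′∈ eq = (e∈ , e′∈ , sym eq) ◅ ε
    along-path e∈ ((x , x∈ , eq′ , refl) ◅ path) e′∈ eq = (e∈ , f⊆T x∈ , sym eq′) ◅ along-path (f⊆T x∈) path e′∈ eq

    -- A step of `L` unfolds into the path of `f` from the end of one outer arc to the start of the
    -- next.
    reach-L⇒K : ∀ {e e′} → Reach L e e′ → Reach K e e′
    reach-L⇒K ε = ε
    reach-L⇒K ((e∈ , x∈ , eq) ◅ r) =
      along-path (q⊆T e∈) (subst (λ v → Star Step v _) (sym eq) (root-path _)) (q⊆T x∈) refl ◅◅ reach-L⇒K r

    private
      -- `g` is the last arc of `q` met so far and `x` the current arc. While the walk stays in `f`,
      -- the root of its position remains the end of `g`; the next arc of `q` then gives a step of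
      -- `L`.
      follow : ∀ {g x e′} → g ∈ q → tgt G g ≡ root (src G x) → x ∈ T → Reach K x e′ → e′ ∈ q → Reach L g e′
      follow g∈ eq x∈ ε e′∈ = (g∈ , e′∈ , eq) ◅ ε
      follow {g} {x} g∈ eq x∈ ((_ , y∈ , eq′) ◅ r) e′∈ with x∈p∪q⁻ q f x∈
      ... | inj₁ x∈q = (g∈ , x∈q , eq) ◅ follow x∈q (trans (sym (root-of-initial (tgt-initial (q⊆A′ x∈q)))) (cong root eq′)) y∈ r e′∈
      ... | inj₂ x∈f = follow g∈ (trans eq (trans (sym (root-path-invariant ((x , x∈f , refl , refl) ◅ ε))) (cong root eq′))) y∈ r e′∈

    reach-K⇒L : ∀ {e e′} → e ∈ q → e′ ∈ q → Reach K e e′ → Reach L e e′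
    reach-K⇒L e∈ e′∈ ε = ε
    reach-K⇒L e∈ e′∈ ((_ , y∈ , eq) ◅ r) =
      follow e∈ (trans (sym (root-of-initial (tgt-initial (q⊆A′ e∈)))) (cong root eq)) y∈ r e′∈

    -- A cycle that misses `q` would lie in the acyclic set `f`.
    cycles-meet-q : (C : Cycle K) → ∃[ e ] e ∈ q × ∃[ i ] Cycle.arc C i ≡ e
    cycles-meet-q C = decide (Fin.any? λ i → Cycle.arc C i ∈? q)
      where
      decide : Dec (∃[ i ] Cycle.arc C i ∈ q) → ∃[ e ] e ∈ q × ∃[ i ] Cycle.arc C i ≡ e
      decide (yes (i , i∈)) = Cycle.arc C i , i∈ , i , refl
      decide (no  none)     = contradiction
        (cycle-circulates K f C λ i → [ (λ i∈q → contradiction (i , i∈q) none) , id ]′ (x∈p∪q⁻ q f (Cycle.arc∈ C i)))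
        acyclic

    cycles-L : ∀ {k} → HasCycles K k → HasCycles L k
    cycles-L = hasCycles-transfer coverK coverL id q⊆T
      (λ e∈ e′∈ → mk⇔ reach-L⇒K (reach-K⇒L e∈ e′∈)) cycles-meet-q

    hamiltonian-G′ : (∀ {e e′} → e ∈ T → e′ ∈ T → Reach K e e′) → Nonempty q → Hamiltonian G′
    hamiltonian-G′ connected (e , e∈) = asCycle (CycleCover.cycleThrough coverL e∈)
      where
      asCycle : Σ (Cycle L) (λ C → CycleCover.Through coverL C e) → Hamiltonian G′
      asCycle (C@record { len = len ; arc = arc ; arc∈ = arc∈ ; consecutive = consecutive ; simple = simple } , on) =
        record { len = len ; arc = arc ; arc∈ = q⊆A′ ∘ arc∈ ; consecutive = consecutive ; simple = simple } , spans
        where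
        spans : ∀ {v} → v ∈ V G′ → ∃[ i ] root (src G (arc i)) ≡ v
        spans {v} v∈ =
          let v∈V , initial = ∈⟦⟧⁻ kept? v∈
              x , x∈ , eq = q-out (path-end∈V (finish-path v) v∈V) (finish-terminal v)
              i , eq′ = CycleCover.reach-through coverL C on (reach-K⇒L e∈ x∈ (connected (q⊆T e∈) (q⊆T x∈)))
          in i , trans (cong (root ∘ src G) eq′) (trans (cong root eq) (root-finish initial))

    hamiltonian-G : (∀ {e e′} → e ∈ q → e′ ∈ q → Reach L e e′) → Nonempty q → Hamiltonian G
    hamiltonian-G connected (e , e∈) = asCycle (CycleCover.cycleThrough coverK (q⊆T e∈))
      where
      asCycle : Σ (Cycle K) (λ C → CycleCover.Through coverK C e) → Hamiltonian G
      asCycle (C@record { len = len ; arc = arc ; arc∈ = arc∈ ; consecutive = consecutive ; simple = simple } , on) =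
        record { len = len ; arc = arc ; arc∈ = T⊆A ∘ arc∈ ; consecutive = consecutive ; simple = simple } , spans
        where
        spans : ∀ {v} → v ∈ V G → ∃[ i ] src G (arc i) ≡ v
        spans {v} v∈ =
          -- From any arc of `T` a path of `f` leads to an arc of `q`. Reachability is symmetric, so
          -- the cycle through `q` also passes the given arc.
          let x , x∈ , eq = T-out v∈
              w = tgt G x
              y , y∈ , eq′ = q-out (path-end∈V (finish-path w) (tgt∈ G (T⊆A x∈))) (finish-terminal w)
              r = along-path x∈ (finish-path w) (q⊆T y∈) eq′
              i , eq″ = CycleCover.reach-through coverK C on
                          (reach-L⇒K (connected e∈ y∈) ◅◅ CycleCover.reach-sym coverK x∈ r)
          in i , trans (cong (src G) eq″) eq

  G′-odd : OddDigraph G → OddDigraph G′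
  G′-odd odd Q = let k , cycles , k-odd = odd W.factor-T in k , W.cycles-L cycles , k-odd
    where
    alternating-Q : ∀ {e} → e ∈ A′ → AlternatingAt (Factor.arcs Q) e
    alternating-Q e∈ = oneSide⇒alternatingAt (A′⊆A e∈)
      (Factor.oneSide Q (G′-AC (hexAC (A′⊆A e∈)) (closed-walk closed-A′ (A′⊆A e∈) e∈ ∘ toℕ)))
    module W = WithOuter (Factor.arcs⊆ Q) alternating-Q

-- Hamiltonian cycles as alternating sets of arcs.

next-injective : ∀ {k} → Injective _≡_ _≡_ (next {k})
next-injective {k} {i} {j} eq with toℕ-next i | toℕ-next j
... | inj₁ (_ , p) | inj₁ (_ , q) = Fin.toℕ-injective (ℕ.suc-injective (trans (sym p) (trans (cong toℕ eq) q)))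
... | inj₁ (_ , p) | inj₂ (_ , q) = contradiction (trans (sym p) (trans (cong toℕ eq) q)) ℕ.1+n≢0
... | inj₂ (_ , p) | inj₁ (_ , q) = contradiction (trans (sym q) (trans (cong toℕ (sym eq)) p)) ℕ.1+n≢0
... | inj₂ (p , _) | inj₂ (q , _) = Fin.toℕ-injective (ℕ.suc-injective (trans p (sym q)))

module _ (G : Digraph) (dd : Is2dd G) where

  open TwoRegular G dd

  -- Serves `G` and its collapse alike, which share arc labels but not incidences. The two
  -- equivalences say that arcs of `S` have a common start or end in `X` just when they have one in
  -- `G`, so `o` and `p` also pair the arcs of `X`.
  module HamiltonianArcs {N} {W : Subset N} {S : Subset (m G)} {σ τ : Fin (m G) → Fin N}
    {src∈W : ∀ {e} → e ∈ S → σ e ∈ W} {tgt∈W : ∀ {e} → e ∈ S → τ e ∈ W} (S⊆A : S ⊆ A G) (closed : Closed (_∈ S))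
    (same-src : ∀ {e e′} → e ∈ S → e′ ∈ S → σ e ≡ σ e′ ⇔ src G e ≡ src G e′)
    (same-tgt : ∀ {e e′} → e ∈ S → e′ ∈ S → τ e ≡ τ e′ ⇔ tgt G e ≡ tgt G e′)
    where

    private
      X : Digraph
      X = record { n = N ; m = m G ; V = W ; A = S ; src = σ ; tgt = τ ; src∈ = src∈W ; tgt∈ = tgt∈W }

    module _ (H : Hamiltonian X) where

      open Cycle (proj₁ H)

      abstract
        arcSet : Subset (m G)
        arcSet = ⟦ onSequence? arc ⟧

        ∈arcSet⁺ : ∀ {e} → (∃[ i ] arc i ≡ e) → e ∈ arcSet
        ∈arcSet⁺ = ∈⟦⟧⁺ (onSequence? arc)

        ∈arcSet⁻ : ∀ {e} → e ∈ arcSet → ∃[ i ] arc i ≡ e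
        ∈arcSet⁻ = ∈⟦⟧⁻ (onSequence? arc)

      arcSet⊆ : arcSet ⊆ S
      arcSet⊆ e∈ = let i , eq = ∈arcSet⁻ e∈ in subst (_∈ S) eq (arc∈ i)

      src-unique : ∀ {e e′} → e ∈ arcSet → e′ ∈ arcSet → σ e ≡ σ e′ → e ≡ e′
      src-unique e∈ e′∈ eq with ∈arcSet⁻ e∈ | ∈arcSet⁻ e′∈
      ... | i , refl | j , refl = cong arc (simple eq)

      tgt-unique : ∀ {e e′} → e ∈ arcSet → e′ ∈ arcSet → τ e ≡ τ e′ → e ≡ e′
      tgt-unique e∈ e′∈ eq with ∈arcSet⁻ e∈ | ∈arcSet⁻ e′∈
      ... | i , refl | j , refl = cong arc (next-injective (simple (trans (sym (consecutive i)) (trans eq (consecutive j)))))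

      src-covered : ∀ {e} → e ∈ S → ∃[ x ] x ∈ arcSet × σ x ≡ σ e
      src-covered e∈ = let i , eq = proj₂ H (src∈W e∈) in arc i , ∈arcSet⁺ (i , refl) , eq

      tgt-covered : ∀ {e} → e ∈ S → ∃[ x ] x ∈ arcSet × τ x ≡ τ e
      tgt-covered e∈ = let i , eq = proj₂ H (tgt∈W e∈)
                           j , eq′ = next-surjective i in
        arc j , ∈arcSet⁺ (j , refl) , trans (consecutive j) (trans (cong (σ ∘ arc) eq′) eq)

      -- The cycle enters and leaves every vertex exactly once, so it takes exactly one arc of each
      -- pair of mates.
      arcSet-alternating : ∀ {e} → e ∈ S → AlternatingAt arcSet e
      arcSet-alternating {e} e∈ = record
        { o-leaves = λ e∈H oe∈H → o≢ e∈A (tgt-unique oe∈H e∈H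
            (Equivalence.from (same-tgt (proj₁ (closed e∈A e∈)) e∈) (tgt-o e∈A)))
        ; o-enters = λ e∉H → let x , x∈ , eq = tgt-covered e∈ in
            other x∈ e∉H (tgt-only e∈A (S⊆A (arcSet⊆ x∈)) (Equivalence.to (same-tgt (arcSet⊆ x∈) e∈) eq))
        ; p-leaves = λ e∈H pe∈H → p≢ e∈A (src-unique pe∈H e∈H
            (Equivalence.from (same-src (proj₂ (closed e∈A e∈)) e∈) (src-p e∈A)))
        ; p-enters = λ e∉H → let x , x∈ , eq = src-covered e∈ in
            other x∈ e∉H (src-only e∈A (S⊆A (arcSet⊆ x∈)) (Equivalence.to (same-src (arcSet⊆ x∈) e∈) eq))
        }
        where
        e∈A : e ∈ A G
        e∈A = S⊆A e∈
        other : ∀ {x y} → x ∈ arcSet → e ∉ arcSet → x ≡ e ⊎ x ≡ y → y ∈ arcSet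
        other x∈ e∉ (inj₁ refl) = contradiction x∈ e∉
        other x∈ e∉ (inj₂ refl) = x∈

      cycleWithin : ∀ {T} (T⊆S : T ⊆ S) → arcSet ⊆ T → Cycle (spanning X T T⊆S)
      cycleWithin T⊆S ⊆T = record
        { len         = len
        ; arc         = arc
        ; arc∈        = λ i → ⊆T (∈arcSet⁺ (i , refl))
        ; consecutive = consecutive
        ; simple      = simple
        }

-- Successors in a cycle cover are unique, so the one that `P` provides is the one the walk takes.
-- Hence `P` contains every cycle of the cover that it meets.
circulating-closed : ∀ G {P f T} (T⊆A : T ⊆ A G) → CycleCover (spanning G T T⊆A) → Circulating G f P → f ⊆ T →
                     ∀ {e e′} → Reach (spanning G T T⊆A) e e′ → e ∈ P → e′ ∈ P
circulating-closed G T⊆A cover circ f⊆T ε e∈ = e∈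
circulating-closed G {P = P} T⊆A cover circ@(_ , P⊆ , after , _) f⊆T ((_ , x∈ , eq) ◅ r) e∈ =
  let y , y∈ , eq′ = after _ e∈ in
  circulating-closed G T⊆A cover circ f⊆T r
    (subst (_∈ P) (CycleCover.src-injective cover (f⊆T (P⊆ y∈)) x∈ (trans (sym eq′) eq)) y∈)

-- The choice of the factor to collapse along.

proposition14 : (G : Digraph) → Is2dd G → Clean G → AllACsOfSize G 6 →
    OddDigraph G → Connected G → ¬ TwoSplittable G →
    (F : Subgraph G) (s : ℕ) → HasACs ⟨ F ⟩ 3 → ∣ saturated ⟨ F ⟩ ∣ ≡ s →
    ¬ (∃[ H ] HasACs (⟨_⟩ {⟨ F ⟩} H) 2 × 2 < ∣ saturated (⟨_⟩ {⟨ F ⟩} H) ∣) →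
    4 < s →
    ∃[ G′ ] Is2dd G′ × AllACsOfSize G′ 6 × OddDigraph G′ × HEquivalent G G′ ×
    (IsCollapse F G′
    ⊎ (∃[ F′ ] Is2Digraph F′ × HasACs F′ 1 × AllACsOfSize F′ 6 × IsReplacement F F′ G′)
    ⊎ (∃[ F′ ] Is2Digraph F′ × HasACs F′ 2 × AllACsOfSize F′ 6 × IsReplacement F F′ G′))
proposition14 G dd clean six odd _ _ F _ three _ few-shared _ = conclude (hamiltonian? G)
  where
  open ClosedSubsets G dd six
  open Subgraph F using (arcs; arcs⊆; nonempty)
  module Three = ThreeHexagonSubgraph G dd clean six F three few-shared

  f₀ : Subset (m G)
  f₀ = proj₁ Three.acyclic-choice
  f₀-acyclic : Acyclic G f₀
  f₀-acyclic = proj₂ (proj₂ (proj₂ Three.acyclic-choice))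
  f₀⊆F : f₀ ⊆ arcs
  f₀⊆F = proj₁ (proj₂ Three.acyclic-choice)
  f₀-alternating : ∀ {e} → e ∈ arcs → AlternatingAt f₀ e
  f₀-alternating = proj₁ (proj₂ (proj₂ Three.acyclic-choice))

  -- If F were all of G, then f₀ would be a factor of the 2-dd G without cycles.
  outside-F : ∃[ e ] e ∈ A G × e ∉ arcs
  outside-F = decidable-stable (Fin.any? λ e → (e ∈? A G) ×-dec ¬? (e ∈? arcs)) λ none →
    let all : ∀ {e} → e ∈ A G → e ∈ arcs
        all {e} e∈ = decidable-stable (e ∈? arcs) λ e∉ → none (e , e∈ , e∉)
        cover = alternating⇒cycleCover (arcs⊆ ∘ f₀⊆F) (f₀-alternating ∘ all)
        C = proj₁ (CycleCover.cycleThrough cover (proj₂ f₀-arc))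
    in f₀-acyclic (cycle-circulates _ f₀ C (Cycle.arc∈ C))
    where
    f₀-arc : ∃[ e ] e ∈ f₀
    f₀-arc = decide (proj₁ nonempty ∈? f₀)
      where
      decide : Dec (proj₁ nonempty ∈ f₀) → ∃[ e ] e ∈ f₀
      decide (yes e∈f₀) = proj₁ nonempty , e∈f₀
      decide (no  e∉f₀) = o (proj₁ nonempty) , AlternatingAt.o-enters (f₀-alternating (proj₂ nonempty)) e∉f₀

  Goal : Set
  Goal = ∃[ G′ ] Is2dd G′ × AllACsOfSize G′ 6 × OddDigraph G′ × HEquivalent G G′ ×
    (IsCollapse F G′
    ⊎ (∃[ F′ ] Is2Digraph F′ × HasACs F′ 1 × AllACsOfSize F′ 6 × IsReplacement F F′ G′)
    ⊎ (∃[ F′ ] Is2Digraph F′ × HasACs F′ 2 × AllACsOfSize F′ 6 × IsReplacement F F′ G′))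

  module Hamiltonian-case (H : Hamiltonian G) where

    open HamiltonianArcs G dd {src∈W = src∈ G} {tgt∈W = tgt∈ G} id (λ e∈ _ → o∈ e∈ , p∈ e∈)
      (λ _ _ → mk⇔ id id) (λ _ _ → mk⇔ id id)

    T₀ : Subset (m G)
    T₀ = arcSet H
    f : Subset (m G)
    f = T₀ ∩ arcs
    f⊆T₀ : f ⊆ T₀
    f⊆T₀ = proj₁ ∘ x∈p∩q⁻ T₀ arcs
    f⊆F : f ⊆ arcs
    f⊆F = proj₂ ∘ x∈p∩q⁻ T₀ arcs
    T₀-alternating : Alternating T₀
    T₀-alternating = arcSet-alternating H
    cover₀ : CycleCover (spanning G T₀ (arcSet⊆ H))
    cover₀ = alternating⇒cycleCover (arcSet⊆ H) T₀-alternating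

    connected₀ : ∀ {e e′} → e ∈ T₀ → e′ ∈ T₀ → Reach (spanning G T₀ (arcSet⊆ H)) e e′
    connected₀ e∈ e′∈ = CycleCover.through-reach cover₀ (cycleWithin H (arcSet⊆ H) id) (∈arcSet⁻ H e∈) (∈arcSet⁻ H e′∈)

    leaves-F : ∃[ e ] e ∈ T₀ × e ∉ arcs
    leaves-F = let e , e∈ , e∉ = outside-F in decide e∈ e∉ (e ∈? T₀)
      where
      decide : ∀ {e} → e ∈ A G → e ∉ arcs → Dec (e ∈ T₀) → ∃[ e ] e ∈ T₀ × e ∉ arcs
      decide {e} e∈ e∉ (yes e∈T₀) = e , e∈T₀ , e∉
      decide {e} e∈ e∉ (no  e∉T₀) = o e , AlternatingAt.o-enters (T₀-alternating e∈) e∉T₀ ,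
        λ oe∈ → e∉ (subst (_∈ arcs) (o-involutive e∈) (proj₁ (Three.arcs-closed (o∈ e∈) oe∈)))

    -- `T₀` is a single cycle, so a circulating part of `f` would be all of it, yet `T₀` has an arc
    -- outside F.
    f-acyclic : Acyclic G f
    f-acyclic (P , circ@((x , x∈) , P⊆ , _)) = let e , e∈T₀ , e∉ = leaves-F in
      e∉ (f⊆F (P⊆ (circulating-closed G {f = f} (arcSet⊆ H) cover₀ circ f⊆T₀ (connected₀ (f⊆T₀ (P⊆ x∈)) e∈T₀) x∈)))

    f-alternating : ∀ {e} → e ∈ arcs → AlternatingAt f e
    f-alternating {e} e∈ = record
      { o-leaves = λ e∈f oe∈f → o-leaves (f⊆T₀ e∈f) (f⊆T₀ oe∈f)
      ; o-enters = λ e∉f → x∈p∩q⁺ (o-enters (λ e∈T₀ → e∉f (x∈p∩q⁺ (e∈T₀ , e∈))) , proj₁ (Three.arcs-closed (arcs⊆ e∈) e∈))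
      ; p-leaves = λ e∈f pe∈f → p-leaves (f⊆T₀ e∈f) (f⊆T₀ pe∈f)
      ; p-enters = λ e∉f → x∈p∩q⁺ (p-enters (λ e∈T₀ → e∉f (x∈p∩q⁺ (e∈T₀ , e∈))) , proj₂ (Three.arcs-closed (arcs⊆ e∈) e∈))
      } where open AlternatingAt (T₀-alternating (arcs⊆ e∈))

    module Collapsed = CollapseAlong G dd six F Three.arcs-closed f f⊆F f-alternating f-acyclic
    open Collapsed using (A′; ∈A′; A′∌; A′⊆A; closed-A′)

    q : Subset (m G)
    q = T₀ ─ arcs
    q⊆T₀ : q ⊆ T₀
    q⊆T₀ = p─q⊆p T₀ arcs
    q⊆A′ : q ⊆ A′
    q⊆A′ e∈ = ∈A′ (arcSet⊆ H (q⊆T₀ e∈)) (x∈p─q⇒x∉q T₀ arcs e∈)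

    q-alternating : ∀ {e} → e ∈ A′ → AlternatingAt q e
    q-alternating {e} e∈ = record
      { o-leaves = λ e∈q oe∈q → o-leaves (q⊆T₀ e∈q) (q⊆T₀ oe∈q)
      ; o-enters = λ e∉q → x∈p∧x∉q⇒x∈p─q (o-enters (λ e∈T₀ → e∉q (x∈p∧x∉q⇒x∈p─q e∈T₀ (A′∌ e∈))))
          (A′∌ (proj₁ (closed-A′ (A′⊆A e∈) e∈)))
      ; p-leaves = λ e∈q pe∈q → p-leaves (q⊆T₀ e∈q) (q⊆T₀ pe∈q)
      ; p-enters = λ e∉q → x∈p∧x∉q⇒x∈p─q (p-enters (λ e∈T₀ → e∉q (x∈p∧x∉q⇒x∈p─q e∈T₀ (A′∌ e∈))))
          (A′∌ (proj₂ (closed-A′ (A′⊆A e∈) e∈)))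
      } where open AlternatingAt (T₀-alternating (A′⊆A e∈))

    module W = Collapsed.WithOuter q⊆A′ q-alternating

    -- Together with `T⊆T₀` this reassembles the Hamiltonian cycle from its parts inside and outside
    -- F, so the factor `W.T` is one cycle.
    T₀⊆T : T₀ ⊆ W.T
    T₀⊆T {e} e∈ = decide (e ∈? arcs)
      where
      decide : Dec (e ∈ arcs) → e ∈ W.T
      decide (yes e∈F) = W.f⊆T (x∈p∩q⁺ (e∈ , e∈F))
      decide (no  e∉F) = W.q⊆T (x∈p∧x∉q⇒x∈p─q e∈ e∉F)

    T⊆T₀ : W.T ⊆ T₀
    T⊆T₀ {e} e∈ = decide (e ∈? arcs)
      where
      decide : Dec (e ∈ arcs) → e ∈ T₀
      decide (yes e∈F) = f⊆T₀ (W.T∩F⊆f e∈F e∈)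
      decide (no  e∉F) = q⊆T₀ (W.T∩A′⊆q (∈A′ (W.T⊆A e∈) e∉F) e∈)

    hamiltonian′ : Hamiltonian Collapsed.G′
    hamiltonian′ = W.hamiltonian-G′
      (λ e∈ e′∈ → CycleCover.through-reach W.coverK (cycleWithin H W.T⊆A T₀⊆T) (∈arcSet⁻ H (T⊆T₀ e∈)) (∈arcSet⁻ H (T⊆T₀ e′∈)))
      (let e , e∈ , e∉ = leaves-F in e , x∈p∧x∉q⇒x∈p─q e∈ e∉)

    goal : Goal
    goal = Collapsed.G′ , Collapsed.G′-2dd , Collapsed.G′-six ,
        Collapsed.G′-odd odd , inj₁ (H , hamiltonian′) , inj₁ Collapsed.isCollapse

  module NonHamiltonian-case (¬H : ¬ Hamiltonian G) where

    module Collapsed = CollapseAlong G dd six F Three.arcs-closed f₀ f₀⊆F f₀-alternating f₀-acyclic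
    open Collapsed using (G′; A′; ∈A′; A′⊆A; closed-A′; src′-reflects; root)

    module _ (H : Hamiltonian G′) where

      open HamiltonianArcs G dd {src∈W = src∈ G′} {tgt∈W = tgt∈ G′} A′⊆A closed-A′
        (λ e∈ e′∈ → mk⇔ (src′-reflects e∈ e′∈) (cong root)) (λ _ _ → mk⇔ id id)

      q : Subset (m G)
      q = arcSet H

      module W = Collapsed.WithOuter (arcSet⊆ H) (arcSet-alternating H)

      q-nonempty : Nonempty q
      q-nonempty = let e , e∈ , e∉ = outside-F
                       x , x∈ , _ = src-covered H (∈A′ e∈ e∉) in x , x∈

      hamiltonian : Hamiltonian G
      hamiltonian = W.hamiltonian-G
        (λ e∈ e′∈ → CycleCover.through-reach W.coverL (cycleWithin H (arcSet⊆ H) id) (∈arcSet⁻ H e∈) (∈arcSet⁻ H e′∈))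
        q-nonempty

    goal : Goal
    goal = G′ , Collapsed.G′-2dd , Collapsed.G′-six ,
        Collapsed.G′-odd odd , inj₂ (¬H , ¬H ∘ hamiltonian) , inj₁ Collapsed.isCollapse

  conclude : Dec (Hamiltonian G) → Goal
  conclude (yes H) = Hamiltonian-case.goal H
  conclude (no ¬H) = NonHamiltonian-case.goal ¬H
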